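{- Let $r=2^f$ with $f\geq 2$, and let $\mathcal{I}=(\rho_1,\ldots,\rho_r)$ where $\rho_1,\ldots,\rho_r:\mathrm{ASL}(2,r)\to S_{r^2}$ are the representations affording the $r$ pairwise inequivalent $2$-transitive actions of $\mathrm{ASL}(2,r)$ of degree $r^2$. Then for each $i=1,\ldots,r$ the code $C(\mathrm{ASL}(2,r),\mathcal{I})$ has the same inner distance distribution, and therefore also the same minimum distance, as $\mathrm{Rep}_r(C(\mathrm{ASL}(2,r),\rho_i))$.
   Context: $\mathrm{ASL}(2,r)=N\rtimes\mathrm{SL}(2,r)$ acts on the row vectors $V=\mathbb{F}_r^2$, where $N$ is the group of translations. It is known that there are exactly $r$ conjugacy classes of complements of $N$ in $\mathrm{ASL}(2,r)$; the $r$ inequivalent $2$-transitive actions of degree $r^2$ are the actions on the right cosets of representatives of these classes. Two actions of a group $G$ on $\Omega,\Omega'$ are equivalent if there is a bijection $\lambda:\Omega\to\Omega'$ with $\lambda(\omega^g)=\lambda(\omega)^g$ for all $\omega\in\Omega$, $g\in G$, and inequivalent otherwise. Actions on sets of size $q=r^2$ are regarded as homomorphisms to $S_q$ by labelling points with $Q=\{1,\ldots,q\}$. For a group $T$ and a homomorphism $\rho:T\to S_q$ put $\alpha(t,\rho)=(1^{t\rho},\ldots,q^{t\rho})\in Q^q$ and $C(T,\rho)=\{\alpha(t,\rho):t\in T\}$. For $\mathcal{I}=(\rho_1,\ldots,\rho_r)$ put $C(T,\mathcal{I})=\{(\alpha(t,\rho_1),\ldots,\alpha(t,\rho_r)):t\in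 T\}\subseteq Q^{rq}$, and $\mathrm{Rep}_r(C(T,\rho))=\{(\alpha,\ldots,\alpha)\ (r\text{ copies}):\alpha\in C(T,\rho)\}$. With $d$ the Hamming distance, the inner distance distribution of a code $C\subseteq Q^m$ is $(a_0,\ldots,a_m)$ with $a_i=|\{(\alpha,\beta)\in C^2:d(\alpha,\beta)=i\}|/|C|$, and the minimum distance is the smallest distance between distinct codewords. -}

module Defs where

open import Level using (Level; _⊔_; 0ℓ)
open import Algebra.Bundles using (AbelianGroup; CommutativeRing; Group)
import Algebra.Construct.DirectProduct as DirectProduct
open import Algebra.Morphism.Bundles using (GroupHomomorphism)
import Algebra.Properties.Ring as RingProperties
import Algebra.Solver.Ring.NaturalCoefficients.Default as SemiringSolver
open import Data.Fin.Base using (Fin; toℕ)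
open import Data.Fin.Permutation as Perm using (Permutation′; _⟨$⟩ʳ_; _∘ₚ_)
open import Data.Fin.Properties using (_≟_)
open import Data.Integer.Base using (+_)
open import Data.List.Base using (length)
open import Data.List.Membership.Propositional using (_∈_)
open import Data.List.Membership.Propositional.Properties.WithK using (unique∧set⇒bag)
open import Data.List.Relation.Binary.BagAndSetEquality using (∼bag⇒↭)
open import Data.List.Relation.Binary.Permutation.Propositional.Properties using (↭-length)
open import Data.List.Relation.Unary.Unique.Propositional using (Unique)
open import Data.Nat.Base using (ℕ; suc; _*_; _≤_)
open import Data.Nat.Properties using (≤-antisym)
open import Data.Product.Base using (∃₂; ∃-syntax; Σ-syntax; _×_; _,_; proj₁)
open import Data.Rational.Base using (ℚ; _/_)
open import Data.Vec.Base using (Vec; concat; count; replicate; tabulate; zip)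
open import Function.Bundles using (_⇔_)
open import Function.Construct.Composition using (_⇔-∘_)
open import Function.Construct.Symmetry using (⇔-sym)
import Relation.Binary.Reasoning.Setoid as SetoidReasoning
open import Relation.Binary.PropositionalEquality as ≡ using (_≡_; _≢_)
open import Relation.Nullary.Decidable using (¬?)
open import Relation.Unary using (Pred)

private
  variable
    a c ℓ p : Level
    m n q : ℕ

module AffineGroup {c ℓ} (R : CommutativeRing c ℓ) where
  private
    open module R = CommutativeRing R
      using (_≈_; _+_; _-_; -_; 0#; 1#; +-cong; +-congˡ; +-congʳ; *-cong; -‿cong;
             +-comm; *-comm; +-identityˡ; +-identityʳ; *-identityˡ; *-identityʳ;
             zeroˡ; zeroʳ; -‿inverseˡ; -‿inverseʳ)
      renaming (Carrier to K; _*_ to infixl 7 _·_)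
    open RingProperties R.ring using (-‿distribˡ-*; -‿distribʳ-*; -‿involutive; -‿+-comm; -0#≈0#)

    open SemiringSolver R.commutativeSemiring using (solve; _:=_; _:+_; _:*_)

  -- The 2 × 2 matrix with rows (e₁₁ e₁₂) and (e₂₁ e₂₂).
  record Mat : Set c where
    constructor mat
    field
      e₁₁ e₁₂ e₂₁ e₂₂ : K

  open Mat

  infix  4 _≈ᴹ_
  infixl 7 _*ᴹ_ _*ᴿ_

  _≈ᴹ_ : Mat → Mat → Set ℓ
  A ≈ᴹ B = (e₁₁ A ≈ e₁₁ B × e₁₂ A ≈ e₁₂ B) × (e₂₁ A ≈ e₂₁ B × e₂₂ A ≈ e₂₂ B)

  _*ᴹ_ : Mat → Mat → Mat
  mat a b c d *ᴹ mat a′ b′ c′ d′ =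
    mat (a · a′ + b · c′) (a · b′ + b · d′)
        (c · a′ + d · c′) (c · b′ + d · d′)

  1ᴹ : Mat
  1ᴹ = mat 1# 0#
           0# 1#

  adj : Mat → Mat
  adj (mat a b c d) = mat d     (- b)
                          (- c) a

  det : Mat → K
  det (mat a b c d) = a · d - b · c

  Row : AbelianGroup c ℓ
  Row = DirectProduct.abelianGroup R.+-abelianGroup R.+-abelianGroup

  module V = AbelianGroup Row

  _*ᴿ_ : V.Carrier → Mat → V.Carrier
  (x , y) *ᴿ mat a b c d = x · a + y · c , x · b + y · d

  ≈ᴹ-refl : ∀ {A} → A ≈ᴹ A
  ≈ᴹ-refl = (R.refl , R.refl) , (R.refl , R.refl)

  ≈ᴹ-sym : ∀ {A B} → A ≈ᴹ B → B ≈ᴹ A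
  ≈ᴹ-sym ((p , q) , (r , s)) = (R.sym p , R.sym q) , (R.sym r , R.sym s)

  ≈ᴹ-trans : ∀ {A B C} → A ≈ᴹ B → B ≈ᴹ C → A ≈ᴹ C
  ≈ᴹ-trans ((p , q) , (r , s)) ((p′ , q′) , (r′ , s′)) =
    (R.trans p p′ , R.trans q q′) , (R.trans r r′ , R.trans s s′)

  *ᴿ-cong : ∀ {v w A B} → v V.≈ w → A ≈ᴹ B → v *ᴿ A V.≈ w *ᴿ B
  *ᴿ-cong (p , q) ((t , u) , (v , w)) =
    +-cong (*-cong p t) (*-cong q v) , +-cong (*-cong p u) (*-cong q w)

  *ᴹ-cong : ∀ {A A′ B B′} → A ≈ᴹ A′ → B ≈ᴹ B′ → A *ᴹ B ≈ᴹ A′ *ᴹ B′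
  *ᴹ-cong (r₁ , r₂) B≈ = *ᴿ-cong r₁ B≈ , *ᴿ-cong r₂ B≈

  *ᴿ-assoc : ∀ v A B → (v *ᴿ A) *ᴿ B V.≈ v *ᴿ (A *ᴹ B)
  *ᴿ-assoc (x , y) (mat a b c d) (mat a′ b′ c′ d′) =
    lemma x y a b c d a′ c′ , lemma x y a b c d b′ d′
    where
    lemma : ∀ x y a b c d e f →
            (x · a + y · c) · e + (x · b + y · d) · f ≈
            x · (a · e + b · f) + y · (c · e + d · f)
    lemma = solve 8 (λ x y a b c d e f →
      ((x :* a :+ y :* c) :* e :+ (x :* b :+ y :* d) :* f) :=
      (x :* (a :* e :+ b :* f) :+ y :* (c :* e :+ d :* f))) R.refl

  *ᴿ-distribʳ : ∀ v w A → (v V.∙ w) *ᴿ A V.≈ (v *ᴿ A) V.∙ (w *ᴿ A)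
  *ᴿ-distribʳ (x , y) (z , w) (mat a b c d) = lemma x y z w a c , lemma x y z w b d
    where
    lemma : ∀ x y z w a b → (x + z) · a + (y + w) · b ≈ (x · a + y · b) + (z · a + w · b)
    lemma = solve 6 (λ x y z w a b →
      ((x :+ z) :* a :+ (y :+ w) :* b) :=
      ((x :* a :+ y :* b) :+ (z :* a :+ w :* b))) R.refl

  *ᴿ-zeroˡ : ∀ A → V.ε *ᴿ A V.≈ V.ε
  *ᴿ-zeroˡ (mat a b c d) = lemma a c , lemma b d
    where
    lemma : ∀ x y → 0# · x + 0# · y ≈ 0#
    lemma x y = R.trans (+-cong (zeroˡ x) (zeroˡ y)) (+-identityˡ 0#)

  *ᴿ-identityʳ : ∀ v → v *ᴿ 1ᴹ V.≈ v
  *ᴿ-identityʳ (x , y) =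
    R.trans (+-cong (*-identityʳ x) (zeroʳ y)) (+-identityʳ x) ,
    R.trans (+-cong (zeroʳ x) (*-identityʳ y)) (+-identityˡ y)

  *ᴿ-neg : ∀ v A → (v V.⁻¹) *ᴿ A V.≈ (v *ᴿ A) V.⁻¹
  *ᴿ-neg (x , y) (mat a b c d) = lemma x y a c , lemma x y b d
    where
    lemma : ∀ x y a b → - x · a + - y · b ≈ - (x · a + y · b)
    lemma x y a b = R.trans
      (+-cong (R.sym (-‿distribˡ-* x a)) (R.sym (-‿distribˡ-* y b)))
      (-‿+-comm (x · a) (y · b))

  *ᴹ-assoc : ∀ A B C → (A *ᴹ B) *ᴹ C ≈ᴹ A *ᴹ (B *ᴹ C)
  *ᴹ-assoc (mat a b c d) B C = *ᴿ-assoc (a , b) B C , *ᴿ-assoc (c , d) B C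

  *ᴹ-identityˡ : ∀ A → 1ᴹ *ᴹ A ≈ᴹ A
  *ᴹ-identityˡ (mat a b c d) = (10-lemma a c , 10-lemma b d) , (01-lemma a c , 01-lemma b d)
    where
    10-lemma : ∀ x y → 1# · x + 0# · y ≈ x
    10-lemma x y = R.trans (+-cong (*-identityˡ x) (zeroˡ y)) (+-identityʳ x)
    01-lemma : ∀ x y → 0# · x + 1# · y ≈ y
    01-lemma x y = R.trans (+-cong (zeroˡ x) (*-identityˡ y)) (+-identityˡ y)

  *ᴹ-identityʳ : ∀ A → A *ᴹ 1ᴹ ≈ᴹ A
  *ᴹ-identityʳ (mat a b c d) = *ᴿ-identityʳ (a , b) , *ᴿ-identityʳ (c , d)

  det-* : ∀ A B → det (A *ᴹ B) ≈ det A · det B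
  det-* (mat a b c d) (mat a′ b′ c′ d′) = begin
    (a · a′ + b · c′) · (c · b′ + d · d′) - (a · b′ + b · d′) · (c · a′ + d · c′)
      ≈⟨ +-cong (expand₁ a b c d a′ b′ c′ d′) (-‿cong (expand₂ a b c d a′ b′ c′ d′)) ⟩
    (x · z + y · w + s) - (x · w + y · z + s)
      ≈⟨ +-congˡ (-‿+-comm (x · w + y · z) s) ⟨
    (x · z + y · w + s) + (- (x · w + y · z) - s)
      ≈⟨ swap (x · z + y · w) s (- (x · w + y · z)) (- s) ⟩
    (x · z + y · w - (x · w + y · z)) + (s - s)
      ≈⟨ R.trans (+-congˡ (-‿inverseʳ s)) (+-identityʳ _) ⟩
    x · z + y · w - (x · w + y · z)
      ≈⟨ +-cong (+-congˡ (neg-neg y w)) (neg-sum x y z w) ⟩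
    x · z + - y · - w + (x · - w + - y · z)
      ≈⟨ factor x (- y) z (- w) ⟩
    (x - y) · (z - w) ∎
    where
    open SetoidReasoning R.setoid
    x = a · d
    y = b · c
    z = a′ · d′
    w = b′ · c′
    s = a · c · (a′ · b′) + b · d · (c′ · d′)
    expand₁ : ∀ a b c d a′ b′ c′ d′ →
      (a · a′ + b · c′) · (c · b′ + d · d′) ≈
      a · d · (a′ · d′) + b · c · (b′ · c′) + (a · c · (a′ · b′) + b · d · (c′ · d′))
    expand₁ = solve 8 (λ a b c d a′ b′ c′ d′ →
      (a :* a′ :+ b :* c′) :* (c :* b′ :+ d :* d′) :=
      a :* d :* (a′ :* d′) :+ b :* c :* (b′ :* c′) :+ (a :* c :* (a′ :* b′) :+ b :* d :* (c′ :* d′)))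
      R.refl
    expand₂ : ∀ a b c d a′ b′ c′ d′ →
      (a · b′ + b · d′) · (c · a′ + d · c′) ≈
      a · d · (b′ · c′) + b · c · (a′ · d′) + (a · c · (a′ · b′) + b · d · (c′ · d′))
    expand₂ = solve 8 (λ a b c d a′ b′ c′ d′ →
      (a :* b′ :+ b :* d′) :* (c :* a′ :+ d :* c′) :=
      a :* d :* (b′ :* c′) :+ b :* c :* (a′ :* d′) :+ (a :* c :* (a′ :* b′) :+ b :* d :* (c′ :* d′)))
      R.refl
    swap : ∀ x y z w → (x + y) + (z + w) ≈ (x + z) + (y + w)
    swap = solve 4 (λ x y z w → (x :+ y) :+ (z :+ w) := (x :+ z) :+ (y :+ w)) R.refl
    factor : ∀ x y z w → x · z + y · w + (x · w + y · z) ≈ (x + y) · (z + w)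
    factor = solve 4 (λ x y z w →
      x :* z :+ y :* w :+ (x :* w :+ y :* z) := (x :+ y) :* (z :+ w)) R.refl
    neg-neg : ∀ y w → y · w ≈ - y · - w
    neg-neg y w = begin
      y · w          ≈⟨ -‿involutive (y · w) ⟨
      - - (y · w)    ≈⟨ -‿cong (-‿distribˡ-* y w) ⟩
      - (- y · w)    ≈⟨ -‿distribʳ-* (- y) w ⟩
      - y · - w      ∎
    neg-sum : ∀ x y z w → - (x · w + y · z) ≈ x · - w + - y · z
    neg-sum x y z w = R.trans (R.sym (-‿+-comm (x · w) (y · z)))
                              (+-cong (-‿distribʳ-* x w) (-‿distribˡ-* y z))

  det-1 : det 1ᴹ ≈ 1#
  det-1 = R.trans (+-cong (*-identityˡ 1#) (R.trans (-‿cong (zeroˡ 0#)) -0#≈0#))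
                  (+-identityʳ 1#)

  det-adj : ∀ A → det (adj A) ≈ det A
  det-adj (mat a b c d) = +-cong (*-comm d a) (-‿cong (begin
    - b · - c      ≈⟨ -‿distribˡ-* b (- c) ⟨
    - (b · - c)    ≈⟨ -‿cong (-‿distribʳ-* b c) ⟨
    - - (b · c)    ≈⟨ -‿involutive (b · c) ⟩
    b · c          ∎))
    where open SetoidReasoning R.setoid

  cancelʳ : ∀ x y → x · - y + y · x ≈ 0#
  cancelʳ x y =
    R.trans (+-cong (R.sym (-‿distribʳ-* x y)) (*-comm y x)) (-‿inverseˡ (x · y))

  cancelˡ : ∀ x y → - x · y + y · x ≈ 0#
  cancelˡ x y =
    R.trans (+-cong (R.sym (-‿distribˡ-* x y)) (*-comm y x)) (-‿inverseˡ (x · y))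

  adj-inverseˡ : ∀ A → det A ≈ 1# → adj A *ᴹ A ≈ᴹ 1ᴹ
  adj-inverseˡ (mat a b c d) D =
    ( R.trans (+-cong (*-comm d a) (R.sym (-‿distribˡ-* b c))) D
    , R.trans (+-comm _ _) (cancelˡ b d) ) ,
    ( cancelˡ c a
    , R.trans (+-comm _ _)
        (R.trans (+-congˡ (R.trans (R.sym (-‿distribˡ-* c b)) (-‿cong (*-comm c b)))) D) )

  adj-inverseʳ : ∀ A → det A ≈ 1# → A *ᴹ adj A ≈ᴹ 1ᴹ
  adj-inverseʳ (mat a b c d) D =
    ( R.trans (+-congˡ (R.sym (-‿distribʳ-* b c))) D , cancelʳ a b ) ,
    ( R.trans (+-comm _ _) (cancelʳ d c)
    , R.trans (+-comm _ _) (R.trans (+-cong (*-comm d a)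
        (R.trans (R.sym (-‿distribʳ-* c b)) (-‿cong (*-comm c b)))) D) )

  adj-cong : ∀ {A B} → A ≈ᴹ B → adj A ≈ᴹ adj B
  adj-cong ((p , q) , (r , s)) = (s , -‿cong q) , (-‿cong r , p)

  SL2 : Group (c ⊔ ℓ) ℓ
  SL2 = record
    { Carrier = ∃[ A ] det A ≈ 1#
    ; _≈_ = λ (A , _) (B , _) → A ≈ᴹ B
    ; _∙_ = λ (A , D) (B , E) →
        A *ᴹ B , R.trans (det-* A B) (R.trans (*-cong D E) (*-identityˡ 1#))
    ; ε = 1ᴹ , det-1
    ; _⁻¹ = λ (A , D) → adj A , R.trans (det-adj A) D
    ; isGroup = record
      { isMonoid = record
        { isSemigroup = record
          { isMagma = record
            { isEquivalence = record { refl = ≈ᴹ-refl ; sym = ≈ᴹ-sym ; trans = ≈ᴹ-trans }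
            ; ∙-cong = *ᴹ-cong }
          ; assoc = λ (A , _) (B , _) (C , _) → *ᴹ-assoc A B C }
        ; identity = (λ (A , _) → *ᴹ-identityˡ A) , (λ (A , _) → *ᴹ-identityʳ A) }
      ; inverse = (λ (A , D) → adj-inverseˡ A D) , (λ (A , D) → adj-inverseʳ A D)
      ; ⁻¹-cong = adj-cong } }

  module S = Group SL2

  -- (A , b) stands for the affine map v ↦ v A + b, and a product is the
  -- composite "left factor first": (v A + b) B + c = v (A B) + (b B + c).
  ASL2 : Group (c ⊔ ℓ) ℓ
  ASL2 = record
    { Carrier = S.Carrier × V.Carrier
    ; _≈_ = λ (A , b) (B , c) → A S.≈ B × b V.≈ c
    ; _∙_ = λ (A , b) (B , c) → A S.∙ B , (b *ᴿ proj₁ B) V.∙ c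
    ; ε = S.ε , V.ε
    ; _⁻¹ = λ (A , b) → A S.⁻¹ , (b *ᴿ proj₁ (A S.⁻¹)) V.⁻¹
    ; isGroup = record
      { isMonoid = record
        { isSemigroup = record
          { isMagma = record
            { isEquivalence = record
              { refl = λ {(A , _)} → S.refl {A} , V.refl
              ; sym = λ {(A , _)} {(B , _)} (p , q) → S.sym {A} {B} p , V.sym q
              ; trans = λ {(A , _)} {(B , _)} {(C , _)} (p , q) (p′ , q′) →
                  S.trans {A} {B} {C} p p′ , V.trans q q′ }
            ; ∙-cong = λ {(A , _)} {(A′ , _)} {(B , _)} {(B′ , _)} (p , q) (p′ , q′) →
                S.∙-cong {A} {A′} {B} {B′} p p′ , V.∙-cong (*ᴿ-cong q p′) q′ }
          ; assoc = λ (A , b) (B , c) (C , d) → S.assoc A B C , shift-assoc b c d (proj₁ B) (proj₁ C) }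
        ; identity =
            (λ (A , b) → S.identityˡ A ,
               V.trans (V.∙-congʳ (*ᴿ-zeroˡ (proj₁ A))) (V.identityˡ b)) ,
            (λ (A , b) → S.identityʳ A ,
               V.trans (V.∙-congʳ (*ᴿ-identityʳ b)) (V.identityʳ b)) }
      ; inverse =
          (λ (A , b) → S.inverseˡ A , shift-inverseˡ A b) ,
          (λ (A , b) → S.inverseʳ A , V.inverseʳ (b *ᴿ proj₁ (A S.⁻¹)))
      ; ⁻¹-cong = λ {(A , _)} {(B , _)} (p , q) →
          S.⁻¹-cong {A} {B} p , V.⁻¹-cong (*ᴿ-cong q (adj-cong p)) } }
    where
    open SetoidReasoning V.setoid
    shift-assoc : ∀ b c d B C →
                  (((b *ᴿ B) V.∙ c) *ᴿ C) V.∙ d V.≈ (b *ᴿ (B *ᴹ C)) V.∙ ((c *ᴿ C) V.∙ d)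
    shift-assoc b c d B C = begin
      (((b *ᴿ B) V.∙ c) *ᴿ C) V.∙ d            ≈⟨ V.∙-congʳ (*ᴿ-distribʳ (b *ᴿ B) c C) ⟩
      (((b *ᴿ B) *ᴿ C) V.∙ (c *ᴿ C)) V.∙ d     ≈⟨ V.∙-congʳ (V.∙-congʳ (*ᴿ-assoc b B C)) ⟩
      ((b *ᴿ (B *ᴹ C)) V.∙ (c *ᴿ C)) V.∙ d     ≈⟨ V.assoc _ _ _ ⟩
      (b *ᴿ (B *ᴹ C)) V.∙ ((c *ᴿ C) V.∙ d)     ∎
    shift-inverseˡ : ∀ A b → (((b *ᴿ proj₁ (A S.⁻¹)) V.⁻¹) *ᴿ proj₁ A) V.∙ b V.≈ V.ε
    shift-inverseˡ (A , D) b = begin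
      (((b *ᴿ adj A) V.⁻¹) *ᴿ A) V.∙ b    ≈⟨ V.∙-congʳ (*ᴿ-neg (b *ᴿ adj A) A) ⟩
      (((b *ᴿ adj A) *ᴿ A) V.⁻¹) V.∙ b    ≈⟨ V.∙-congʳ (V.⁻¹-cong (*ᴿ-assoc b (adj A) A)) ⟩
      ((b *ᴿ (adj A *ᴹ A)) V.⁻¹) V.∙ b
        ≈⟨ V.∙-congʳ (V.⁻¹-cong (*ᴿ-cong {A = adj A *ᴹ A} V.refl (adj-inverseˡ A D))) ⟩
      ((b *ᴿ 1ᴹ) V.⁻¹) V.∙ b              ≈⟨ V.∙-congʳ (V.⁻¹-cong (*ᴿ-identityʳ b)) ⟩
      (b V.⁻¹) V.∙ b                      ≈⟨ V.inverseˡ b ⟩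
      V.ε                                 ∎

open AffineGroup public using (ASL2)

-- ∘ₚ composes from left to right, so homomorphisms into this group are
-- right actions.
symmetricGroup : ℕ → Group 0ℓ 0ℓ
symmetricGroup q = record
  { Carrier = Permutation′ q
  ; _≈_ = Perm._≈_
  ; _∙_ = _∘ₚ_
  ; ε = Perm.id
  ; _⁻¹ = Perm.flip
  ; isGroup = record
    { isMonoid = record
      { isSemigroup = record
        { isMagma = record
          { isEquivalence = record
            { refl = λ _ → ≡.refl
            ; sym = λ p i → ≡.sym (p i)
            ; trans = λ p q i → ≡.trans (p i) (q i) }
          ; ∙-cong = λ {π} {π′} {σ} {σ′} p q i →
              ≡.trans (q (π ⟨$⟩ʳ i)) (≡.cong (σ′ ⟨$⟩ʳ_) (p i)) }
        ; assoc = λ _ _ _ _ → ≡.refl }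
      ; identity = (λ _ _ → ≡.refl) , (λ _ _ → ≡.refl) }
    ; inverse = (λ π _ → Perm.inverseʳ π) , (λ π _ → Perm.inverseˡ π)
    ; ⁻¹-cong = λ {π} {σ} p i → ≡.trans
        (≡.sym (Perm.inverseˡ σ))
        (≡.cong (σ Perm.⟨$⟩ˡ_) (≡.trans (≡.sym (p (π Perm.⟨$⟩ˡ i))) (Perm.inverseʳ π))) } }

PermRep : Group c ℓ → ℕ → Set (c ⊔ ℓ)
PermRep T q = GroupHomomorphism (Group.rawGroup T) (Group.rawGroup (symmetricGroup q))

Code : ℕ → ℕ → (p : Level) → Set (Level.suc p)
Code q m p = Pred (Vec (Fin q) m) p

module _ (T : Group c ℓ) where
  open Group T using (Carrier)
  open GroupHomomorphism using (⟦_⟧)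

  TwoTransitive : PermRep T q → Set c
  TwoTransitive {q} ρ = ∀ (ω₁ ω₂ ω₁′ ω₂′ : Fin q) → ω₁ ≢ ω₂ → ω₁′ ≢ ω₂′ →
    ∃[ t ] (⟦ ρ ⟧ t ⟨$⟩ʳ ω₁ ≡ ω₁′ × ⟦ ρ ⟧ t ⟨$⟩ʳ ω₂ ≡ ω₂′)

  Equivalent : PermRep T q → PermRep T q → Set c
  Equivalent {q} ρ σ = Σ[ l ∈ Permutation′ q ] (∀ (ω : Fin q) (t : Carrier) →
    l ⟨$⟩ʳ (⟦ ρ ⟧ t ⟨$⟩ʳ ω) ≡ ⟦ σ ⟧ t ⟨$⟩ʳ (l ⟨$⟩ʳ ω))

  α : Carrier → PermRep T q → Vec (Fin q) q
  α t ρ = tabulate (⟦ ρ ⟧ t ⟨$⟩ʳ_)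

  -- C(T, ρ)
  permCode : PermRep T q → Code q q c
  permCode ρ w = ∃[ t ] w ≡ α t ρ

  -- C(T, (ρ₁, …, ρₙ))
  familyCode : (Fin n → PermRep T q) → Code q (n * q) c
  familyCode ρ w = ∃[ t ] w ≡ concat (tabulate (λ i → α t (ρ i)))

Rep : ∀ n → Code q m p → Code q (n * m) p
Rep n C w = ∃[ v ] (C v × w ≡ concat (replicate n v))

hamming : Vec (Fin q) m → Vec (Fin q) m → ℕ
hamming v w = count (λ (x , y) → ¬? (x ≟ y)) (zip v w)

HasSize : {A : Set a} → Pred A p → ℕ → Set (a ⊔ p)
HasSize {A = A} P n = ∃[ xs ] (Unique xs × (∀ (x : A) → x ∈ xs ⇔ P x) × length xs ≡ n)

PairsAtDistance : Code q m p → ℕ → Pred (Vec (Fin q) m × Vec (Fin q) m) p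
PairsAtDistance C d (v , w) = C v × C w × hamming v w ≡ d

-- The size of the code is written suc n because the distribution of the
-- empty code is undefined.
IsInnerDistanceDistribution : Code q m p → (Fin (suc m) → ℚ) → Set p
IsInnerDistanceDistribution C a = ∀ i → ∃₂ λ k n →
  HasSize (PairsAtDistance C (toℕ i)) k × HasSize C (suc n) × a i ≡ + k / suc n

IsMinimumDistance : Code q m p → ℕ → Set p
IsMinimumDistance C δ =
  (∃₂ λ v w → C v × C w × v ≢ w × hamming v w ≡ δ) ×
  (∀ v w → C v → C w → v ≢ w → δ ≤ hamming v w)

-- The relations above are single-valued, so two codes have the same
-- distribution (minimum distance) as soon as they have a common one.

HasSize-unique : {A : Set a} {P : Pred A p} → HasSize P m → HasSize P n → m ≡ n
HasSize-unique (xs , xs! , xs⇔P , ≡.refl) (ys , ys! , ys⇔P , ≡.refl) =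
  ↭-length (∼bag⇒↭ (unique∧set⇒bag xs! ys! λ {x} → ⇔-sym (ys⇔P x) ⇔-∘ xs⇔P x))

innerDistanceDistribution-unique : {C : Code q m p} {a b : Fin (suc m) → ℚ} →
  IsInnerDistanceDistribution C a → IsInnerDistanceDistribution C b → ∀ i → a i ≡ b i
innerDistanceDistribution-unique Ca Cb i with Ca i | Cb i
... | k , n , pairs , size , a≡ | k′ , n′ , pairs′ , size′ , b≡
  with HasSize-unique pairs pairs′ | HasSize-unique size size′
... | ≡.refl | ≡.refl = ≡.trans a≡ (≡.sym b≡)

minimumDistance-unique : {C : Code q m p} {δ ε : ℕ} →
  IsMinimumDistance C δ → IsMinimumDistance C ε → δ ≡ ε
minimumDistance-unique ((v , w , Cv , Cw , v≢w , ≡.refl) , δ≤)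
                       ((v′ , w′ , Cv′ , Cw′ , v′≢w′ , ≡.refl) , ε≤) =
  ≤-antisym (δ≤ v′ w′ Cv′ Cw′ v′≢w′) (ε≤ v w Cv Cw v≢w)

{-# OPTIONS --safe #-}
module Submission where

-- In a 2-transitive action of degree q = r² the translation group N acts non-trivially, because
-- |SL(2,r)| ≤ r³ < q(q - 1); being normal it is then transitive, and having order q it is regular.
-- Fix a point ω, let t = (A , b) and let d ∈ N be such that ωᵗ = ω + d.  The fixed points ω + n of t
-- are the solutions of d + nA = n, so two such actions, with d and d′, have equally many points
-- fixed by t as soon as d - d′ lies in the image of A - 1.  If tr A ≠ 0, then A - 1 is invertible
-- since det (A - 1) = - tr A.  If tr A = 0, then t² is the translation by bA + b in
-- characteristic 2, so d + dA = bA + b = d′ + d′A, and d - d′ lies in the kernel of A - 1, which is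
-- its image unless A = 1, in which case d = b = d′.  Since the distance of α(s,ρ) and α(t,ρ) is the
-- number of points moved by st⁻¹, it does not depend on ρ.

open import Defs
open import Algebra.Apartness.Bundles using (HeytingCommutativeRing; HeytingField)
open import Algebra.Bundles using (CommutativeRing; Group)
open import Algebra.Morphism.Bundles using (GroupHomomorphism)
import Algebra.Properties.CommutativeMonoid.Sum as CommutativeMonoidSum
import Algebra.Properties.Group as GroupProperties
import Algebra.Properties.Semiring.Mult as SemiringMult
import Algebra.Solver.Ring.NaturalCoefficients.Default as SemiringSolver
open import Data.Bool.Base using (if_then_else_)
open import Data.Fin.Base using (Fin; zero; suc; toℕ; combine; remQuot; punchIn; punchOut)
open import Data.Fin.Permutation as Perm using (Permutation′; _⟨$⟩ʳ_)
import Data.Fin.Properties as Fin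
import Data.Integer.Base as ℤ
open import Data.List.Base using (List; []; _∷_; allFin; cartesianProduct; deduplicate; filter; length; lookup; map)
import Data.List.Extrema as Extrema
open import Data.List.Membership.Propositional using (_∈_)
open import Data.List.Membership.Propositional.Properties
  using (∈-allFin; ∈-cartesianProduct⁺; ∈-filter⁺; ∈-filter⁻; ∈-lookup; ∈-map⁺; ∈-map⁻)
open import Data.List.Properties using (length-map; length-tabulate)
import Data.List.Relation.Unary.All as All
import Data.List.Relation.Unary.All.Properties as All
open import Data.List.Relation.Unary.AllPairs using (_∷_)
import Data.List.Relation.Unary.Any as Any
import Data.List.Relation.Unary.Any.Properties as Any
import Data.List.Relation.Unary.Enumerates.Setoid as Enumerates
import Data.List.Relation.Unary.Enumerates.Setoid.Properties as Enumerates
import Data.List.Relation.Unary.Unique.DecSetoid.Properties as UniqueDecSetoid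
import Data.List.Relation.Unary.Unique.Propositional.Properties as Unique
import Data.List.Relation.Unary.Unique.Setoid as UniqueSetoid
open import Data.Nat.Base as ℕ using (ℕ; zero; suc; _≤_; _*_; _^_; s≤s; z≤n)
import Data.Nat.Properties as ℕ
open import Data.Product.Base using (_×_; _,_; ∃; ∃-syntax; Σ-syntax; proj₁; proj₂; uncurry)
open import Data.Product.Relation.Binary.Pointwise.NonDependent using (_×ₛ_)
open import Data.Rational.Base using (ℚ; _/_)
open import Data.Vec.Base as Vec using (Vec; []; _∷_; _++_; concat; replicate; tabulate)
import Data.Vec.Properties as Vec
open import Data.Vec.Relation.Binary.Pointwise.Inductive as Pointwise using (Pointwise; []; _∷_)
open import Function.Base using (_∘_; id)
open import Function.Bundles using (Equivalence; Inverse; _⇔_; mk⇔)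
open import Function.Construct.Composition using (_⇔-∘_)
open import Function.Construct.Identity using (⇔-id)
open import Function.Construct.Symmetry using (⇔-sym)
open import Function.Definitions using (Injective)
open import Level using (Level; _⊔_; 0ℓ)
open import Relation.Binary.Bundles using (DecSetoid; Setoid)
import Relation.Binary.Construct.On as On
open import Relation.Binary.Definitions using (Decidable)
open import Relation.Binary.PropositionalEquality as ≡ using (_≡_; _≢_; cong; cong₂; setoid; subst)
import Relation.Binary.Reasoning.Setoid as SetoidReasoning
open import Relation.Nullary.Decidable using (Dec; decidable-stable; does; map′; no; yes; ¬?)
open import Relation.Nullary.Negation using (¬_; contradiction)

private
  variable
    a p : Level
    m n q : ℕ

-- Hamming distance of concatenated, tabulated and repeated words.

mismatch : Fin q → Fin q → ℕ
mismatch x y = if does (¬? (x Fin.≟ y)) then 1 else 0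

mismatch-cong : {w x y z : Fin q} → (w ≡ x ⇔ y ≡ z) → mismatch w x ≡ mismatch y z
mismatch-cong {w = w} {x} {y} {z} w≡x⇔y≡z with w Fin.≟ x | y Fin.≟ z
... | yes _   | yes _   = ≡.refl
... | no _    | no _    = ≡.refl
... | yes w≡x | no y≢z  = contradiction (Equivalence.to w≡x⇔y≡z w≡x) y≢z
... | no w≢x  | yes y≡z = contradiction (Equivalence.from w≡x⇔y≡z y≡z) w≢x

hamming-∷ : ∀ (x y : Fin q) (v w : Vec (Fin q) m) →
            hamming (x ∷ v) (y ∷ w) ≡ mismatch x y ℕ.+ hamming v w
hamming-∷ x y v w with x Fin.≟ y
... | yes _ = ≡.refl
... | no _  = ≡.refl

hamming-++ : ∀ (v v′ : Vec (Fin q) m) (w w′ : Vec (Fin q) n) →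
             hamming (v ++ w) (v′ ++ w′) ≡ hamming v v′ ℕ.+ hamming w w′
hamming-++ []      []        w w′ = ≡.refl
hamming-++ (x ∷ v) (x′ ∷ v′) w w′ = begin
  hamming (x ∷ v ++ w) (x′ ∷ v′ ++ w′)                   ≡⟨ hamming-∷ x x′ (v ++ w) (v′ ++ w′) ⟩
  mismatch x x′ ℕ.+ hamming (v ++ w) (v′ ++ w′)          ≡⟨ cong (mismatch x x′ ℕ.+_) (hamming-++ v v′ w w′) ⟩
  mismatch x x′ ℕ.+ (hamming v v′ ℕ.+ hamming w w′)      ≡⟨ ℕ.+-assoc (mismatch x x′) _ _ ⟨
  mismatch x x′ ℕ.+ hamming v v′ ℕ.+ hamming w w′        ≡⟨ cong (ℕ._+ hamming w w′) (hamming-∷ x x′ v v′) ⟨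
  hamming (x ∷ v) (x′ ∷ v′) ℕ.+ hamming w w′             ∎
  where open ≡.≡-Reasoning

hamming-concat : ∀ {d} {vs ws : Vec (Vec (Fin q) m) n} →
                 Pointwise (λ v w → hamming v w ≡ d) vs ws → hamming (concat vs) (concat ws) ≡ n * d
hamming-concat                           []             = ≡.refl
hamming-concat {vs = v ∷ vs} {ws = w ∷ ws} (v~w ∷ vs~ws) =
  ≡.trans (hamming-++ v w (concat vs) (concat ws)) (cong₂ ℕ._+_ v~w (hamming-concat vs~ws))

hamming-refl : ∀ (v : Vec (Fin q) m) → hamming v v ≡ 0
hamming-refl []      = ≡.refl
hamming-refl (x ∷ v) with x Fin.≟ x
... | yes _  = hamming-refl v
... | no x≢x = contradiction ≡.refl x≢x

hamming≡0⇒≡ : ∀ (v w : Vec (Fin q) m) → hamming v w ≡ 0 → v ≡ w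
hamming≡0⇒≡ []      []      _    = ≡.refl
hamming≡0⇒≡ (x ∷ v) (y ∷ w) v~w with x Fin.≟ y
... | yes ≡.refl = cong (x ∷_) (hamming≡0⇒≡ v w v~w)
hamming≡0⇒≡ (x ∷ v) (y ∷ w) () | no _

-- Distance 0 means equality, so two parametrisations with the same distances identify the same
-- parameters.
hamming-reflects-≡ : ∀ {v w : Vec (Fin q) m} {v′ w′ : Vec (Fin q) n} →
                     hamming v w ≡ hamming v′ w′ → v ≡ w → v′ ≡ w′
hamming-reflects-≡ {v = v} {v′ = v′} {w′} eq ≡.refl =
  hamming≡0⇒≡ v′ w′ (≡.trans (≡.sym eq) (hamming-refl v))

module ℕSum = CommutativeMonoidSum ℕ.+-0-commutativeMonoid

hamming-tabulate : ∀ (f g : Fin m → Fin q) →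
                   hamming (tabulate f) (tabulate g) ≡ ℕSum.sum (λ i → mismatch (f i) (g i))
hamming-tabulate {m = zero}  f g = ≡.refl
hamming-tabulate {m = suc m} f g =
  ≡.trans (hamming-∷ (f zero) (g zero) (tabulate (f ∘ suc)) (tabulate (g ∘ suc)))
          (cong (mismatch (f zero) (g zero) ℕ.+_) (hamming-tabulate (f ∘ suc) (g ∘ suc)))

-- The distance is a sum of mismatches over the positions, and reindexing along `π` does not change
-- the sum. For two actions, `π` will come from matching the points fixed by one group element.
hamming-tabulate-permute : ∀ (f g f′ g′ : Fin m → Fin q) (π : Permutation′ m) →
  (∀ i → f i ≡ g i ⇔ f′ (π ⟨$⟩ʳ i) ≡ g′ (π ⟨$⟩ʳ i)) →
  hamming (tabulate f) (tabulate g) ≡ hamming (tabulate f′) (tabulate g′)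
hamming-tabulate-permute f g f′ g′ π f≡g⇔f′≡g′ = begin
  hamming (tabulate f) (tabulate g)                            ≡⟨ hamming-tabulate f g ⟩
  ℕSum.sum (λ i → mismatch (f i) (g i))                        ≡⟨ ℕSum.sum-cong-≗ (λ i → mismatch-cong (f≡g⇔f′≡g′ i)) ⟩
  ℕSum.sum (λ i → mismatch (f′ (π ⟨$⟩ʳ i)) (g′ (π ⟨$⟩ʳ i)))    ≡⟨ ℕSum.sum-permute (λ i → mismatch (f′ i) (g′ i)) π ⟨
  ℕSum.sum (λ i → mismatch (f′ i) (g′ i))                      ≡⟨ hamming-tabulate f′ g′ ⟨
  hamming (tabulate f′) (tabulate g′)                          ∎
  where open ≡.≡-Reasoning

hamming-replicate : ∀ n (v w : Vec (Fin q) m) →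
  hamming (concat (replicate n v)) (concat (replicate n w)) ≡ n * hamming v w
hamming-replicate n v w = hamming-concat (pointwise n)
  where
  pointwise : ∀ n → Pointwise (λ v′ w′ → hamming v′ w′ ≡ hamming v w) (replicate n v) (replicate n w)
  pointwise zero    = []
  pointwise (suc n) = ≡.refl ∷ pointwise n

-- Distance distribution and minimum distance from a table of distances.

module _ (h : Fin (suc n) → Fin (suc n) → ℕ) where

  open Extrema ℕ.≤-totalOrder using (argmin; argmin-all; f[argmin]≤f[xs])

  indexPairs : List (Fin (suc n) × Fin (suc n))
  indexPairs = cartesianProduct (allFin (suc n)) (allFin (suc n))

  pairsAt : ℕ → List (Fin (suc n) × Fin (suc n))
  pairsAt d = filter (λ (i , j) → h i j ℕ.≟ d) indexPairs

  distribution : Fin (suc m) → ℚ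
  distribution d = ℤ.+ length (pairsAt (toℕ d)) / suc n

  distinctPairs : List (Fin (suc n) × Fin (suc n))
  distinctPairs = filter (λ (i , j) → ¬? (i Fin.≟ j)) indexPairs

  -- The pair `ij` is the starting value of the minimum and takes part in it, which is why
  -- `isMinimumDistance` asks for distinct indices.
  closestPair : Fin (suc n) × Fin (suc n) → Fin (suc n) × Fin (suc n)
  closestPair ij = argmin (uncurry h) ij distinctPairs

  ∈-indexPairs : ∀ i j → (i , j) ∈ indexPairs
  ∈-indexPairs i j = ∈-cartesianProduct⁺ (∈-allFin i) (∈-allFin j)

  -- Everything in the two conclusions depends on h only, so codes with the same h share them.
  module Parametrised {C : Code q m p} (word : Fin (suc n) → Vec (Fin q) m)
    (C⇔ : ∀ w → C w ⇔ ∃ λ i → w ≡ word i)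
    (word-injective : ∀ {i j} → word i ≡ word j → i ≡ j)
    (hamming≡h : ∀ i j → hamming (word i) (word j) ≡ h i j) where

    private
      inC : ∀ i → C (word i)
      inC i = Equivalence.from (C⇔ (word i)) (i , ≡.refl)

      fromC : ∀ {w} → C w → ∃ λ i → w ≡ word i
      fromC {w} = Equivalence.to (C⇔ w)

      words : Fin (suc n) × Fin (suc n) → Vec (Fin q) m × Vec (Fin q) m
      words (i , j) = word i , word j

      words-injective : ∀ {ij kl} → words ij ≡ words kl → ij ≡ kl
      words-injective eq = cong₂ _,_ (word-injective (cong proj₁ eq)) (word-injective (cong proj₂ eq))

    hasSize : HasSize C (suc n)
    hasSize = map word (allFin (suc n))
            , Unique.map⁺ word-injective (Unique.allFin⁺ (suc n))
            , (λ w → mk⇔ (to w) (from w))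
            , ≡.trans (length-map word (allFin (suc n))) (length-tabulate {n = suc n} id)
      where
      to : ∀ w → w ∈ map word (allFin (suc n)) → C w
      to w w∈ with i , _ , ≡.refl ← ∈-map⁻ word w∈ = inC i
      from : ∀ w → C w → w ∈ map word (allFin (suc n))
      from w Cw with i , ≡.refl ← fromC Cw = ∈-map⁺ word (∈-allFin i)

    pairsHaveSize : ∀ d → HasSize (PairsAtDistance C d) (length (pairsAt d))
    pairsHaveSize d = map words (pairsAt d)
      , Unique.map⁺ words-injective
          (Unique.filter⁺ h≟d (Unique.cartesianProduct⁺ (Unique.allFin⁺ _) (Unique.allFin⁺ _)))
      , (λ vw → mk⇔ (to vw) (from vw))
      , length-map words (pairsAt d)
      where
      h≟d : ∀ ij → Dec (uncurry h ij ≡ d)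
      h≟d (i , j) = h i j ℕ.≟ d
      to : ∀ vw → vw ∈ map words (pairsAt d) → PairsAtDistance C d vw
      to vw vw∈ with (i , j) , ij∈ , ≡.refl ← ∈-map⁻ words vw∈ =
        inC i , inC j , ≡.trans (hamming≡h i j) (proj₂ (∈-filter⁻ h≟d {xs = indexPairs} ij∈))
      from : ∀ vw → PairsAtDistance C d vw → vw ∈ map words (pairsAt d)
      from (v , w) (Cv , Cw , v~w) with fromC Cv | fromC Cw
      ... | i , ≡.refl | j , ≡.refl =
        ∈-map⁺ words (∈-filter⁺ h≟d (∈-indexPairs i j) (≡.trans (≡.sym (hamming≡h i j)) v~w))

    isInnerDistanceDistribution : IsInnerDistanceDistribution C distribution
    isInnerDistanceDistribution d =
      length (pairsAt (toℕ d)) , n , pairsHaveSize (toℕ d) , hasSize , ≡.refl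

    isMinimumDistance : ∀ {i j} → i ≢ j → IsMinimumDistance C (uncurry h (closestPair (i , j)))
    isMinimumDistance {i} {j} i≢j =
      (word k , word l , inC k , inC l , k≢l ∘ word-injective , hamming≡h k l) , minimal
      where
      k l : Fin (suc n)
      k = proj₁ (closestPair (i , j))
      l = proj₂ (closestPair (i , j))
      i≟j : ∀ (ij : Fin (suc n) × Fin (suc n)) → Dec (proj₁ ij ≢ proj₂ ij)
      i≟j (i , j) = ¬? (i Fin.≟ j)
      k≢l : k ≢ l
      k≢l = argmin-all (uncurry h) {xs = distinctPairs} {P = λ (i , j) → i ≢ j} i≢j (All.all-filter i≟j indexPairs)
      minimal : ∀ v w → C v → C w → v ≢ w → h k l ≤ hamming v w
      minimal v w Cv Cw v≢w with fromC Cv | fromC Cw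
      ... | i′ , ≡.refl | j′ , ≡.refl = subst (h k l ≤_) (≡.sym (hamming≡h i′ j′))
        (All.lookup (f[argmin]≤f[xs] {f = uncurry h} (i , j) distinctPairs)
          (∈-filter⁺ i≟j (∈-indexPairs i′ j′) (v≢w ∘ cong word)))

-- Numbering the codewords without repetition; isometric codes.

unique⇒lookup-injective : ∀ {ℓ} (S : Setoid a ℓ) {xs : List (Setoid.Carrier S)} →
  UniqueSetoid.Unique S xs → ∀ i j → Setoid._≈_ S (lookup xs i) (lookup xs j) → i ≡ j
unique⇒lookup-injective S (x∉xs ∷ _)  zero    zero    _  = ≡.refl
unique⇒lookup-injective S (x∉xs ∷ _)  zero    (suc j) eq = contradiction eq (All.lookup x∉xs (∈-lookup j))
unique⇒lookup-injective S (x∉xs ∷ _)  (suc i) zero    eq =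
  contradiction (Setoid.sym S eq) (All.lookup x∉xs (∈-lookup i))
unique⇒lookup-injective S (_ ∷ xs!)   (suc i) (suc j) eq = cong suc (unique⇒lookup-injective S xs! i j eq)

module _ {ℓ} (D : DecSetoid a ℓ) where

  open DecSetoid D using (Carrier; _≈_; _≟_) renaming (setoid to S; sym to ≈-sym)

  -- Deduplication leaves one representative of each class. The element supplied shows that there is
  -- a class at all, hence the index set `Fin (suc n)`.
  enumeratedQuotient : ∀ {xs : List Carrier} → Enumerates.IsEnumeration S xs → Carrier →
    ∃ λ n → Σ[ e ∈ (Fin (suc n) → Carrier) ]
      ((∀ {i j} → e i ≈ e j → i ≡ j) × (∀ x → ∃ λ i → x ≈ e i))
  enumeratedQuotient {xs} xs-enum x
    with deduplicate _≟_ xs | UniqueDecSetoid.deduplicate-! D xs | Enumerates.deduplicate⁺ D xs-enum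
  ... | []     | _   | enum with () ← enum x
  ... | y ∷ ys | ys! | enum =
    length ys , lookup (y ∷ ys) , (λ {i} {j} → unique⇒lookup-injective S ys! i j) ,
    λ z → let i , eq = Enumerates.lookup-surjective S enum z in i , ≈-sym (eq ≡.refl)

reindex : {X : Set a} {C : Code q m p} (word : X → Vec (Fin q) m) →
  (∀ w → C w ⇔ ∃ λ t → w ≡ word t) → (e : Fin n → X) → (∀ t → ∃ λ i → word t ≡ word (e i)) →
  ∀ w → C w ⇔ ∃ λ i → w ≡ word (e i)
reindex {C = C} word C⇔ e e-surjective w = mk⇔ to (λ (i , w≡) → Equivalence.from (C⇔ w) (e i , w≡))
  where
  to : C w → ∃ λ i → w ≡ word (e i)
  to Cw with t , w≡ ← Equivalence.to (C⇔ w) Cw with i , t≡ ← e-surjective t = i , ≡.trans w≡ t≡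

module _ {X : Set a} {C C′ : Code q m p} (word word′ : X → Vec (Fin q) m)
  (C⇔ : ∀ w → C w ⇔ ∃ λ t → w ≡ word t) (C′⇔ : ∀ w → C′ w ⇔ ∃ λ t → w ≡ word′ t)
  (isometric : ∀ s t → hamming (word s) (word t) ≡ hamming (word′ s) (word′ t)) where

  private
    -- Parameters are compared by their words, so the classes correspond to the codewords even if
    -- several parameters give one word.
    D : DecSetoid a 0ℓ
    D = On.decSetoid (≡.decSetoid (Vec.≡-dec Fin._≟_)) word

  isometricCodes : ∀ {xs} → Enumerates.IsEnumeration (DecSetoid.setoid D) xs →
    ∀ {s t} → word s ≢ word t →
    (Σ[ a ∈ (Fin (suc m) → ℚ) ] (IsInnerDistanceDistribution C a × IsInnerDistanceDistribution C′ a)) ×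
    (Σ[ δ ∈ ℕ ] (IsMinimumDistance C δ × IsMinimumDistance C′ δ))
  isometricCodes xs-enum {s} {t} s≢t with enumeratedQuotient D xs-enum s
  ... | n , e , e-injective , e-surjective =
    (distribution h , P.isInnerDistanceDistribution , P′.isInnerDistanceDistribution) ,
    (_ , P.isMinimumDistance i≢j , P′.isMinimumDistance i≢j)
    where
    h : Fin (suc n) → Fin (suc n) → ℕ
    h i j = hamming (word (e i)) (word (e j))
    e-surjective′ : ∀ t → ∃ λ i → word′ t ≡ word′ (e i)
    e-surjective′ t with i , t≡ ← e-surjective t = i , hamming-reflects-≡ (isometric t (e i)) t≡
    e-injective′ : ∀ {i j} → word′ (e i) ≡ word′ (e j) → i ≡ j
    e-injective′ {i} {j} eq = e-injective (hamming-reflects-≡ (≡.sym (isometric (e i) (e j))) eq)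
    module P = Parametrised h {C = C} (word ∘ e) (reindex word C⇔ e e-surjective)
      e-injective (λ _ _ → ≡.refl)
    module P′ = Parametrised h {C = C′} (word′ ∘ e) (reindex word′ C′⇔ e e-surjective′)
      e-injective′ (λ i j → ≡.sym (isometric (e i) (e j)))
    i≢j : proj₁ (e-surjective s) ≢ proj₁ (e-surjective t)
    i≢j i≡j = s≢t (≡.trans (proj₂ (e-surjective s))
                     (≡.trans (cong (word ∘ e) i≡j) (≡.sym (proj₂ (e-surjective t)))))

-- Counting arguments.

injective⇒surjective : ∀ {m n} {f : Fin m → Fin n} → m ≡ n → Injective _≡_ _≡_ f → ∀ y → ∃ λ x → f x ≡ y
injective⇒surjective {suc _} {f = f} ≡.refl f-injective y with Fin.any? (λ x → f x Fin.≟ y)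
... | yes hit = hit
... | no miss = contradiction (Fin.injective⇒≤ g-injective) ℕ.1+n≰n
  where
  y≢f : ∀ x → y ≢ f x
  y≢f x y≡fx = miss (x , ≡.sym y≡fx)
  g-injective : Injective _≡_ _≡_ (λ x → punchOut (y≢f x))
  g-injective eq = f-injective (Fin.punchOut-injective (y≢f _) (y≢f _) eq)

-- Cancelling r² would leave r² ≤ r + 1, whereas r + 1 < r + r ≤ r².
r²[r²∸1]≰r³ : ∀ {r} → 2 ≤ r → ¬ (r ℕ.* r ℕ.* ℕ.pred (r ℕ.* r) ≤ r ℕ.* r ℕ.* r)
r²[r²∸1]≰r³ {suc r-1} 2≤r le = ℕ.<⇒≱ 1+r<r² (s≤s (ℕ.*-cancelˡ-≤ (r ℕ.* r) le))
  where
  r = suc r-1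
  1+r<r² : suc r ℕ.< r ℕ.* r
  1+r<r² = ℕ.<-≤-trans (ℕ.+-monoˡ-≤ r 2≤r)
    (ℕ.≤-trans (ℕ.≤-reflexive (cong (r ℕ.+_) (≡.sym (ℕ.+-identityʳ r)))) (ℕ.*-monoˡ-≤ r 2≤r))

-- `punchIn i` runs through the points other than `i`, so the ordered pairs of distinct points are
-- indexed by q (q - 1) numbers.
distinctPairs-≤ : ∀ {q N} (g : ∀ (i j : Fin q) → i ≢ j → Fin N) →
  (∀ {i j i′ j′} i≢j i′≢j′ → g i j i≢j ≡ g i′ j′ i′≢j′ → i ≡ i′ × j ≡ j′) → q ℕ.* ℕ.pred q ≤ N
distinctPairs-≤ {zero}  _ _ = z≤n
distinctPairs-≤ {suc p} {N} g g-injective = Fin.injective⇒≤ {f = h ∘ remQuot p} injective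
  where
  i≢ : ∀ i j → i ≢ punchIn i j
  i≢ i j = Fin.punchInᵢ≢i i j ∘ ≡.sym
  h : Fin (suc p) × Fin p → Fin N
  h (i , j) = g i (punchIn i j) (i≢ i j)
  h-injective : ∀ ij kl → h ij ≡ h kl → ij ≡ kl
  h-injective (i , j) (k , l) eq with g-injective (i≢ i j) (i≢ k l) eq
  ... | ≡.refl , j≡l = cong (i ,_) (Fin.punchIn-injective i j l j≡l)
  injective : Injective _≡_ _≡_ (h ∘ remQuot p)
  injective {x} {y} eq = begin
    x                                ≡⟨ Fin.combine-remQuot {suc p} p x ⟨
    uncurry combine (remQuot p x)    ≡⟨ cong (uncurry combine) (h-injective (remQuot p x) (remQuot p y) eq) ⟩
    uncurry combine (remQuot p y)    ≡⟨ Fin.combine-remQuot {suc p} p y ⟩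
    y                                ∎
    where open ≡.≡-Reasoning

2≤q : ∀ {q r} → q ≡ r ℕ.* r → 2 ≤ r → 2 ≤ q
2≤q {r = suc _} ≡.refl 2≤r = ℕ.≤-trans 2≤r (ℕ.m≤m*n _ _)

distinctPoints : ∀ {q} → 2 ≤ q → ∃[ i ] ∃[ j ] _≢_ {A = Fin q} i j
distinctPoints (s≤s (s≤s _)) = zero , suc zero , λ ()

-- Permutation actions: distances and fixed points.

module Action {c ℓ} (G : Group c ℓ) {q} (ρ : PermRep G q) where

  private
    module G = Group G
    module ρ = GroupHomomorphism ρ

  act : G.Carrier → Fin q → Fin q
  act t ω = ρ.⟦ t ⟧ ⟨$⟩ʳ ω

  act-cong : ∀ {s t} → s G.≈ t → ∀ ω → act s ω ≡ act t ω
  act-cong = ρ.⟦⟧-cong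

  act-∙ : ∀ s t ω → act (s G.∙ t) ω ≡ act t (act s ω)
  act-∙ = ρ.homo

  act-ε : ∀ ω → act G.ε ω ≡ ω
  act-ε = ρ.ε-homo

  agree⇔fixed : ∀ s t ω → act s ω ≡ act t ω ⇔ act (s G.∙ t G.⁻¹) ω ≡ ω
  agree⇔fixed s t ω = mk⇔
    (λ eq → begin
      act (s G.∙ t G.⁻¹) ω          ≡⟨ act-∙ s (t G.⁻¹) ω ⟩
      act (t G.⁻¹) (act s ω)        ≡⟨ cong (act (t G.⁻¹)) eq ⟩
      act (t G.⁻¹) (act t ω)        ≡⟨ act-∙ t (t G.⁻¹) ω ⟨
      act (t G.∙ t G.⁻¹) ω          ≡⟨ act-cong (G.inverseʳ t) ω ⟩
      act G.ε ω                     ≡⟨ act-ε ω ⟩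
      ω                             ∎)
    (λ fix → begin
      act s ω                          ≡⟨ act-ε (act s ω) ⟨
      act G.ε (act s ω)                ≡⟨ act-cong (G.inverseˡ t) (act s ω) ⟨
      act (t G.⁻¹ G.∙ t) (act s ω)     ≡⟨ act-∙ (t G.⁻¹) t (act s ω) ⟩
      act t (act (t G.⁻¹) (act s ω))   ≡⟨ cong (act t) (act-∙ s (t G.⁻¹) ω) ⟨
      act t (act (s G.∙ t G.⁻¹) ω)     ≡⟨ cong (act t) fix ⟩
      act t ω                          ∎)
    where open ≡.≡-Reasoning

module _ {c ℓ} (G : Group c ℓ) {q} (ρ σ : PermRep G q) where

  private
    module G = Group G
    module ρ = Action G ρ
    module σ = Action G σ

  -- The bijection may change with `u`, so the hypothesis amounts to equal numbers of fixed points
  -- and is weaker than equivalence of the actions. It is applied to u = st⁻¹.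
  fixedPoints⇒hamming :
    (∀ u → Σ[ π ∈ Permutation′ q ] (∀ ω → ρ.act u ω ≡ ω ⇔ σ.act u (π ⟨$⟩ʳ ω) ≡ π ⟨$⟩ʳ ω)) →
    ∀ s t → hamming (α G s ρ) (α G t ρ) ≡ hamming (α G s σ) (α G t σ)
  fixedPoints⇒hamming fixed s t with π , fixed⇔ ← fixed (s G.∙ t G.⁻¹) =
    hamming-tabulate-permute (ρ.act s) (ρ.act t) (σ.act s) (σ.act t) π λ ω →
      ⇔-sym (σ.agree⇔fixed s t (π ⟨$⟩ʳ ω)) ⇔-∘ (fixed⇔ ω ⇔-∘ ρ.agree⇔fixed s t ω)

-- The code of a family against a repetition code.

module _ {c ℓ} (G : Group c ℓ) {n q} (ρ : Fin n → PermRep G q) (i : Fin n) where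

  private
    module G = Group G
    open module ρᵢ = Action G (ρ i) using (act)

    familyWord repWord : G.Carrier → Vec (Fin q) (n * q)
    familyWord t = concat (tabulate (λ j → α G t (ρ j)))
    repWord t = concat (replicate n (α G t (ρ i)))

  module _ (hamming-α : ∀ j s t → hamming (α G s (ρ j)) (α G t (ρ j)) ≡ hamming (α G s (ρ i)) (α G t (ρ i))) where

    private
      hamming-family : ∀ s t → hamming (familyWord s) (familyWord t) ≡ n * hamming (α G s (ρ i)) (α G t (ρ i))
      hamming-family s t = hamming-concat (Pointwise.tabulate⁺ (λ j → hamming-α j s t))

      isometric : ∀ s t → hamming (familyWord s) (familyWord t) ≡ hamming (repWord s) (repWord t)
      isometric s t = ≡.trans (hamming-family s t) (≡.sym (hamming-replicate n (α G s (ρ i)) (α G t (ρ i))))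

      rep⇔ : ∀ w → Rep n (permCode G (ρ i)) w ⇔ ∃ λ t → w ≡ repWord t
      rep⇔ w = mk⇔ (λ { (_ , (t , ≡.refl) , w≡) → t , w≡ }) (λ (t , w≡) → α G t (ρ i) , (t , ≡.refl) , w≡)

      familyWord-cong : ∀ {s t} → s G.≈ t → familyWord s ≡ familyWord t
      familyWord-cong s≈t = cong concat (Vec.tabulate-cong λ j → Vec.tabulate-cong (Action.act-cong G (ρ j) s≈t))

      familyWord-≢ : ∀ {s t} ω → act s ω ≢ act t ω → familyWord s ≢ familyWord t
      familyWord-≢ {s} {t} ω s≢t eq = s≢t (begin
        act s ω                                  ≡⟨ Vec.lookup∘tabulate (act s) ω ⟨
        Vec.lookup (α G s (ρ i)) ω               ≡⟨ cong (λ v → Vec.lookup v ω) α-≡ ⟩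
        Vec.lookup (α G t (ρ i)) ω               ≡⟨ Vec.lookup∘tabulate (act t) ω ⟩
        act t ω                                  ∎)
        where
        open ≡.≡-Reasoning
        zero-distance : n * hamming (α G s (ρ i)) (α G t (ρ i)) ≡ 0
        zero-distance = begin
          n * hamming (α G s (ρ i)) (α G t (ρ i))    ≡⟨ hamming-family s t ⟨
          hamming (familyWord s) (familyWord t)      ≡⟨ cong (hamming (familyWord s)) eq ⟨
          hamming (familyWord s) (familyWord s)      ≡⟨ hamming-refl (familyWord s) ⟩
          0                                          ∎
        -- The index `i` excludes n = 0, where the product would vanish for every distance.
        n*d≡0 : ∀ {n d} → Fin n → n * d ≡ 0 → d ≡ 0
        n*d≡0 {suc n} _ eq = ℕ.m+n≡0⇒m≡0 _ eq
        α-≡ : α G s (ρ i) ≡ α G t (ρ i)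
        α-≡ = hamming≡0⇒≡ (α G s (ρ i)) (α G t (ρ i)) (n*d≡0 i zero-distance)

    familyCode~Rep : ∀ {ts} → Enumerates.IsEnumeration G.setoid ts → ∀ {s t} ω → act s ω ≢ act t ω →
      (Σ[ a ∈ (Fin (suc (n * q)) → ℚ) ]
        (IsInnerDistanceDistribution (familyCode G ρ) a ×
         IsInnerDistanceDistribution (Rep n (permCode G (ρ i))) a)) ×
      (Σ[ δ ∈ ℕ ]
        (IsMinimumDistance (familyCode G ρ) δ ×
         IsMinimumDistance (Rep n (permCode G (ρ i))) δ))
    familyCode~Rep enum ω s≢t = isometricCodes familyWord repWord (λ _ → ⇔-id _) rep⇔ isometric
      (λ t → Any.map familyWord-cong (enum t)) (familyWord-≢ ω s≢t)

-- Finite fields and their characteristic.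

ring : ∀ {c ℓ₁ ℓ₂} → HeytingField c ℓ₁ ℓ₂ → CommutativeRing c ℓ₁
ring F = HeytingCommutativeRing.commutativeRing (HeytingField.heytingCommutativeRing F)

CharacteristicTwo : ∀ {c ℓ} → CommutativeRing c ℓ → Set (c ⊔ ℓ)
CharacteristicTwo R = ∀ x → x + x ≈ 0#
  where open CommutativeRing R

module FiniteField {c ℓ₁ ℓ₂} (F : HeytingField c ℓ₁ ℓ₂)
  {r} (K↔Fin : Inverse (CommutativeRing.setoid (ring F)) (setoid (Fin r))) where

  private R = ring F
  open HeytingField F using (_#_; tight; #⇒invertible)
  open CommutativeRing R renaming (_*_ to infixl 7 _·_; setoid to K)
  open Inverse K↔Fin using (to; from; to-cong; from-cong; strictlyInverseˡ; strictlyInverseʳ)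
  open GroupProperties +-group using (ε⁻¹≈ε; identityʳ-unique; //-rightDividesˡ; //-rightDividesʳ)
    renaming (inverseˡ-unique to +-inverseˡ-unique)
  open CommutativeMonoidSum +-commutativeMonoid using (sum; sum-permute; ∑-distrib-+; sum-replicate; sum-cong-≋)
  open SemiringMult semiring using (×-homo-1; ×1-homo-*) renaming (_×_ to infixr 8 _•_)
  open SemiringSolver commutativeSemiring using (solve; _:=_; _:+_; _:*_; con)
  open SetoidReasoning K

  to-injective : ∀ {x y} → to x ≡ to y → x ≈ y
  to-injective {x} {y} eq = trans (sym (strictlyInverseʳ x)) (trans (from-cong eq) (strictlyInverseʳ y))

  infix 4 _≟_
  _≟_ : Decidable _≈_
  x ≟ y = map′ to-injective to-cong (to x Fin.≟ to y)

  -- The field axioms only give ¬ ¬ (x # 0), so the inverse has to be searched for.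
  invertible : ∀ {x} → ¬ (x ≈ 0#) → ∃[ y ] y · x ≈ 1#
  invertible {x} x≉0 with Fin.any? (λ i → from i · x ≟ 1#)
  ... | yes (i , eq) = from i , eq
  ... | no ∄ = contradiction (proj₁ (tight x 0#) ¬x#0) x≉0
    where
    ¬x#0 : ¬ (x # 0#)
    ¬x#0 x#0 with y , yx≈1 , _ ← #⇒invertible x#0 = ∄ (to y , (begin
      from (to y) · x    ≈⟨ *-cong (strictlyInverseʳ y) (sym (trans (+-congˡ ε⁻¹≈ε) (+-identityʳ x))) ⟩
      y · (x - 0#)       ≈⟨ yx≈1 ⟩
      1#                 ∎))

  *-cancelˡ : ∀ {x y z} → ¬ (x ≈ 0#) → x · y ≈ x · z → y ≈ z
  *-cancelˡ {x} {y} {z} x≉0 xy≈xz with t , T ← invertible x≉0 = begin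
    y              ≈⟨ trans (*-congʳ T) (*-identityˡ y) ⟨
    t · x · y      ≈⟨ *-assoc t x y ⟩
    t · (x · y)    ≈⟨ *-congˡ xy≈xz ⟩
    t · (x · z)    ≈⟨ *-assoc t x z ⟨
    t · x · z      ≈⟨ trans (*-congʳ T) (*-identityˡ z) ⟩
    z              ∎

  x*y≈0⇒y≈0 : ∀ {x y} → ¬ (x ≈ 0#) → x · y ≈ 0# → y ≈ 0#
  x*y≈0⇒y≈0 {x} x≉0 xy≈0 = *-cancelˡ x≉0 (trans xy≈0 (sym (zeroʳ x)))

  -- Translation by 1 permutes the field, so the sum of all elements absorbs r • 1.
  order×1≈0 : r • 1# ≈ 0#
  order×1≈0 = identityʳ-unique (sum from) (r • 1#) (sym (begin
    sum from                             ≈⟨ sum-permute from shift ⟩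
    sum (λ i → from (to (from i + 1#)))  ≈⟨ sum-cong-≋ (λ i → strictlyInverseʳ (from i + 1#)) ⟩
    sum (λ i → from i + 1#)              ≈⟨ ∑-distrib-+ from (λ _ → 1#) ⟩
    sum from + sum {r} (λ _ → 1#)        ≈⟨ +-congˡ (sum-replicate r) ⟩
    sum from + r • 1#                    ∎))
    where
    shift : Permutation′ r
    shift = Perm.permutation (λ i → to (from i + 1#)) (λ i → to (from i - 1#))
      (λ i → ≡.trans (to-cong (trans (+-congʳ (strictlyInverseʳ _)) (//-rightDividesˡ 1# (from i)))) (strictlyInverseˡ i))
      (λ i → ≡.trans (to-cong (trans (+-congʳ (strictlyInverseʳ _)) (//-rightDividesʳ 1# (from i)))) (strictlyInverseˡ i))

  -- If 2 ≠ 0, a factor 2 can be cancelled from 2^f = 0, and this is repeated down to 1 = 0, which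
  -- again gives 2 = 0.
  2^f×1≈0⇒2×1≈0 : ∀ f → (2 ^ f) • 1# ≈ 0# → 2 • 1# ≈ 0#
  2^f×1≈0⇒2×1≈0 zero    eq = begin
    1# + 1 • 1#        ≈⟨ +-cong (trans (sym (×-homo-1 1#)) eq) eq ⟩
    0# + 0#            ≈⟨ +-identityˡ 0# ⟩
    0#                 ∎
  2^f×1≈0⇒2×1≈0 (suc f) eq with 2 • 1# ≟ 0#
  ... | yes 2≈0 = 2≈0
  ... | no 2≉0  = 2^f×1≈0⇒2×1≈0 f (x*y≈0⇒y≈0 2≉0 (trans (sym (×1-homo-* 2 (2 ^ f))) eq))

  order-2^f⇒characteristicTwo : ∀ f → r ≡ 2 ^ f → CharacteristicTwo R
  order-2^f⇒characteristicTwo f ≡.refl x = begin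
    x + x              ≈⟨ solve 1 (λ x → x :+ x := (con 1 :+ con 1) :* x) refl x ⟩
    (1# + 1#) · x      ≈⟨ *-congʳ (+-congˡ (×-homo-1 1#)) ⟨
    2 • 1# · x         ≈⟨ *-congʳ (2^f×1≈0⇒2×1≈0 f order×1≈0) ⟩
    0# · x             ≈⟨ zeroˡ x ⟩
    0#                 ∎

  -- Enumeration of the affine group.

  open AffineGroup R hiding (ASL2)
  open Mat

  scalars : List Carrier
  scalars = map from (allFin r)

  rows : List V.Carrier
  rows = cartesianProduct scalars scalars

  scalars-enumerate : Enumerates.IsEnumeration K scalars
  scalars-enumerate x = Any.map⁺ (Any.map (λ eq → trans (sym (strictlyInverseʳ x)) (from-cong eq)) (∈-allFin (to x)))

  rows-enumerate : Enumerates.IsEnumeration V.setoid rows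
  rows-enumerate = Enumerates.cartesianProduct⁺ K K scalars-enumerate scalars-enumerate

  det-cong : ∀ {A B} → A ≈ᴹ B → det A ≈ det B
  det-cong ((a , b) , (c , d)) = +-cong (*-cong a d) (-‿cong (*-cong b c))

  -- The identity stands in for the pairs of rows whose determinant is not 1.
  fromRows : V.Carrier × V.Carrier → S.Carrier
  fromRows ((a , b) , (c , d)) with det (mat a b c d) ≟ 1#
  ... | yes D = mat a b c d , D
  ... | no _  = S.ε

  fromRows-≈ : ∀ ((mat a b c d , D) : S.Carrier) (((a′ , b′) , (c′ , d′)) : V.Carrier × V.Carrier) →
    mat a b c d ≈ᴹ mat a′ b′ c′ d′ → mat a b c d ≈ᴹ proj₁ (fromRows ((a′ , b′) , (c′ , d′)))
  fromRows-≈ (A , D) ((a′ , b′) , (c′ , d′)) A≈ with det (mat a′ b′ c′ d′) ≟ 1#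
  ... | yes _ = A≈
  ... | no ¬D = contradiction (trans (sym (det-cong A≈)) D) ¬D

  fromTriple : (V.Carrier × V.Carrier) × V.Carrier → Group.Carrier (ASL2 R)
  fromTriple (A , b) = fromRows A , b

  -- Repetitions occur, as `fromRows` returns the identity for every unsuitable pair of rows; they
  -- disappear when parameters are identified by their words.
  elements : List (Group.Carrier (ASL2 R))
  elements = map fromTriple (cartesianProduct (cartesianProduct rows rows) rows)

  elements-enumerate : Enumerates.IsEnumeration (Group.setoid (ASL2 R)) elements
  elements-enumerate ((mat a b c d , D) , v) = Any.map⁺ (Any.map
    (λ {(A , w)} (A≈ , v≈) → fromRows-≈ (mat a b c d , D) A A≈ , v≈)
    (triples-enumerate (((a , b) , (c , d)) , v)))
    where
    triples-enumerate : Enumerates.IsEnumeration ((V.setoid ×ₛ V.setoid) ×ₛ V.setoid)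
                          (cartesianProduct (cartesianProduct rows rows) rows)
    triples-enumerate = Enumerates.cartesianProduct⁺ (V.setoid ×ₛ V.setoid) V.setoid
      (Enumerates.cartesianProduct⁺ V.setoid V.setoid rows-enumerate rows-enumerate) rows-enumerate

  -- Images of A - 1 in characteristic 2.

  module InCharacteristicTwo (x+x≈0 : CharacteristicTwo R) where

    -x≈x : ∀ x → - x ≈ x
    -x≈x x = sym (+-inverseˡ-unique x x (x+x≈0 x))

    -- Lets characteristic 2 enter calculations with the semiring solver: the terms that cancel are
    -- collected as `z + z`, so that the remaining identity holds in every commutative semiring.
    dropDouble : ∀ {x y} z → x ≈ y + (z + z) → x ≈ y
    dropDouble {x} {y} z eq = trans eq (trans (+-congˡ (x+x≈0 z)) (+-identityʳ y))

    swapMiddle : ∀ {x y z w} → x + y ≈ z + w → y + w ≈ x + z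
    swapMiddle {x} {y} {z} {w} eq = begin
      y + w              ≈⟨ dropDouble x (solve 3 (λ x y w → (x :+ y) :+ w :+ x := y :+ w :+ (x :+ x)) refl x y w) ⟨
      (x + y) + w + x    ≈⟨ +-congʳ (+-congʳ eq) ⟩
      (z + w) + w + x    ≈⟨ dropDouble w (solve 3 (λ x z w → (z :+ w) :+ w :+ x := x :+ z :+ (w :+ w)) refl x z w) ⟩
      x + z              ∎

    det≈1 : ∀ {a b c d} → det (mat a b c d) ≈ 1# → a · d ≈ 1# + b · c
    det≈1 {a} {b} {c} {d} det≈1 = begin
      a · d                      ≈⟨ //-rightDividesˡ (b · c) (a · d) ⟨
      a · d - b · c + b · c      ≈⟨ +-congʳ det≈1 ⟩
      1# + b · c                 ∎

    -- det (A - 1) = - tr A when det A = 1, so the adjugate of A - 1 over tr A is its inverse.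
    solve-trace≉0 : ∀ {a b c d} x y t → a · d ≈ 1# + b · c → t · (a + d) ≈ 1# →
      (t · (x · (d + 1#) + y · c)) · a + (t · (y · (a + 1#) + x · b)) · c ≈
      t · (x · (d + 1#) + y · c) + x
    solve-trace≉0 {a} {b} {c} {d} x y t D T = begin
      (t · (x · (d + 1#) + y · c)) · a + (t · (y · (a + 1#) + x · b)) · c
        ≈⟨ dropDouble (t · (y · (a · c))) (solve 7 (λ a b c d x y t →
             (t :* (x :* (d :+ con 1) :+ y :* c)) :* a :+ (t :* (y :* (a :+ con 1) :+ x :* b)) :* c :=
             t :* (x :* (a :* d) :+ (x :* a :+ x :* (b :* c) :+ y :* c)) :+ (t :* (y :* (a :* c)) :+ t :* (y :* (a :* c))))
             refl a b c d x y t) ⟩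
      t · (x · (a · d) + (x · a + x · (b · c) + y · c))
        ≈⟨ *-congˡ (+-congʳ (*-congˡ D)) ⟩
      t · (x · (1# + b · c) + (x · a + x · (b · c) + y · c))
        ≈⟨ dropDouble (t · (x · (b · c))) (solve 6 (λ a b c x y t →
             t :* (x :* (con 1 :+ b :* c) :+ (x :* a :+ x :* (b :* c) :+ y :* c)) :=
             t :* (x :+ x :* a :+ y :* c) :+ (t :* (x :* (b :* c)) :+ t :* (x :* (b :* c))))
             refl a b c x y t) ⟩
      t · (x + x · a + y · c)
        ≈⟨ dropDouble (t · (x · d)) (solve 6 (λ a c d x y t →
             t :* (x :* (d :+ con 1) :+ y :* c) :+ (t :* (a :+ d)) :* x :=
             t :* (x :+ x :* a :+ y :* c) :+ (t :* (x :* d) :+ t :* (x :* d)))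
             refl a c d x y t) ⟨
      t · (x · (d + 1#) + y · c) + (t · (a + d)) · x
        ≈⟨ +-congˡ (trans (*-congʳ T) (*-identityˡ x)) ⟩
      t · (x · (d + 1#) + y · c) + x ∎

    -- Here `t` is 1/b. The second coordinate of vA = v reads xb = y(1 + d), so, as a = d, the
    -- vector v = (x, y) is y/b times the first row (a + 1, b) of A - 1. Its preimage is (yt, 0).
    solve-trace≈0 : ∀ {a b d} x y t → a ≈ d → x · b + y · d ≈ y → t · b ≈ 1# →
      ((y · t) · a ≈ y · t + x) × ((y · t) · b ≈ y)
    solve-trace≈0 {a} {b} {d} x y t a≈d fixed T = first , trans (*-assoc y t b) (trans (*-congˡ T) (*-identityʳ y))
      where
      xb≈ : x · b ≈ y + y · d
      xb≈ = dropDouble (y · d) (begin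
        x · b                        ≈⟨ dropDouble (y · d) (+-assoc _ _ _) ⟨
        x · b + y · d + y · d        ≈⟨ +-congʳ fixed ⟩
        y + y · d                    ≈⟨ dropDouble (y · d) refl ⟨
        y + y · d + (y · d + y · d)  ∎)
      first : (y · t) · a ≈ y · t + x
      first = begin
        (y · t) · a               ≈⟨ *-congˡ a≈d ⟩
        (y · t) · d               ≈⟨ dropDouble (y · t) (solve 3 (λ y t d →
                                       y :* t :+ t :* (y :+ y :* d) := (y :* t) :* d :+ (y :* t :+ y :* t)) refl y t d) ⟨
        y · t + t · (y + y · d)   ≈⟨ +-congˡ (*-congˡ xb≈) ⟨
        y · t + t · (x · b)       ≈⟨ +-congˡ (solve 3 (λ t x b → t :* (x :* b) := x :* (t :* b)) refl t x b) ⟩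
        y · t + x · (t · b)       ≈⟨ +-congˡ (trans (*-congˡ T) (*-identityʳ x)) ⟩
        y · t + x                 ∎

    -- (x + 1)² = x² + 1 = 0, and a field has no zero divisors.
    x*x≈1⇒x≈1 : ∀ x → x · x ≈ 1# → x ≈ 1#
    x*x≈1⇒x≈1 x xx≈1 with x + 1# ≟ 0#
    ... | yes x+1≈0 = trans (+-inverseˡ-unique x 1# x+1≈0) (-x≈x 1#)
    ... | no x+1≉0 = contradiction (x*y≈0⇒y≈0 x+1≉0 (begin
      (x + 1#) · (x + 1#)    ≈⟨ dropDouble x (solve 1 (λ x → (x :+ con 1) :* (x :+ con 1) := x :* x :+ con 1 :+ (x :+ x)) refl x) ⟩
      x · x + 1#             ≈⟨ +-congʳ xx≈1 ⟩
      1# + 1#                ≈⟨ x+x≈0 1# ⟩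
      0#                     ∎)) x+1≉0

    -- The case tr A = 0, det A = 1 of Cayley-Hamilton, A² = (tr A) A - det A, since -1 = 1.
    square≈1 : ∀ A → det A ≈ 1# → e₁₁ A ≈ e₂₂ A → A *ᴹ A ≈ᴹ 1ᴹ
    square≈1 (mat a b c d) D a≈d =
      ( diagonal (trans (*-congˡ a≈d) (det≈1 D)) , trans (+-congʳ (trans (*-comm a b) (*-congˡ a≈d))) (x+x≈0 (b · d)) ) ,
      ( trans (+-congˡ (trans (*-comm d c) (*-congˡ (sym a≈d)))) (x+x≈0 (c · a))
      , trans (+-comm _ _) (trans (+-congˡ (*-comm c b)) (diagonal (trans (*-congʳ (sym a≈d)) (det≈1 D)))) )
      where
      diagonal : ∀ {x} → x ≈ 1# + b · c → x + b · c ≈ 1#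
      diagonal {x} eq = dropDouble (b · c) (trans (+-congʳ eq) (+-assoc _ _ _))

    -- The conclusion puts v in the image of A - 1. The condition vA = v is imposed only for tr A =
    -- 0, when (A - 1)² = A² + 1 = 0; the kernel of A - 1 is then its image unless A = 1, where v
    -- must be zero.
    ∃-displacement : ∀ A v → det A ≈ 1# →
      (A ≈ᴹ 1ᴹ → v V.≈ V.ε) → (e₁₁ A ≈ e₂₂ A → v *ᴿ A V.≈ v) →
      ∃[ w ] w *ᴿ A V.≈ w V.∙ v
    ∃-displacement (mat a b c d) (x , y) D identity fixed with a + d ≟ 0#
    ... | no tr≉0 with t , T ← invertible tr≉0 =
      (t · (x · (d + 1#) + y · c) , t · (y · (a + 1#) + x · b)) ,
      solve-trace≉0 x y t (det≈1 D) T ,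
      -- The second coordinate follows from the first by exchanging the two basis vectors: x with y,
      -- a with d, b with c.
      trans (+-comm _ _) (solve-trace≉0 y x t
        (trans (*-comm d a) (trans (det≈1 D) (+-congˡ (*-comm b c))))
        (trans (*-congˡ (+-comm d a)) T))
    ... | yes tr≈0 = traceless (b ≟ 0#) (c ≟ 0#)
      where
      A = mat a b c d
      a≈d : a ≈ d
      a≈d = trans (+-inverseˡ-unique a d tr≈0) (-x≈x d)
      traceless : Dec (b ≈ 0#) → Dec (c ≈ 0#) → ∃[ w ] w *ᴿ A V.≈ w V.∙ (x , y)
      traceless (no b≉0) _ with t , T ← invertible b≉0
        with p , q ← solve-trace≈0 x y t a≈d (proj₂ (fixed a≈d)) T =
        (y · t , 0#) ,
        trans (trans (+-congˡ (zeroˡ c)) (+-identityʳ _)) p ,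
        trans (trans (+-congˡ (zeroˡ d)) (+-identityʳ _)) (trans q (sym (+-identityˡ y)))
      -- The same exchange of basis vectors puts c in the place of b, so the preimage is a multiple
      -- of the second basis vector.
      traceless (yes _) (no c≉0) with t , T ← invertible c≉0
        with p , q ← solve-trace≈0 y x t (sym a≈d) (trans (+-comm _ _) (proj₁ (fixed a≈d))) T =
        (0# , x · t) ,
        trans (trans (+-congʳ (zeroˡ a)) (+-identityˡ _)) (trans q (sym (+-identityˡ x))) ,
        trans (trans (+-congʳ (zeroˡ b)) (+-identityˡ _)) p
      -- A is scalar with a² = 1, so A = 1, v = 0, and the zero vector is a preimage.
      traceless (yes b≈0) (yes c≈0) =
        V.ε , V.trans (*ᴿ-zeroˡ A) (V.sym (V.trans (V.identityˡ _) (identity A≈1)))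
        where
        a≈1 : a ≈ 1#
        a≈1 = x*x≈1⇒x≈1 a (begin
          a · a          ≈⟨ *-congˡ a≈d ⟩
          a · d          ≈⟨ det≈1 D ⟩
          1# + b · c     ≈⟨ +-congˡ (trans (*-congʳ b≈0) (zeroˡ c)) ⟩
          1# + 0#        ≈⟨ +-identityʳ 1# ⟩
          1#             ∎)
        A≈1 : A ≈ᴹ 1ᴹ
        A≈1 = (a≈1 , b≈0) , (c≈0 , trans (sym a≈d) a≈1)

-- Translations, and a bound on the order of SL(2,r).

module AffineAction {c ℓ₁ ℓ₂} (F : HeytingField c ℓ₁ ℓ₂)
  {r} (K↔Fin : Inverse (CommutativeRing.setoid (ring F)) (setoid (Fin r)))
  (2≤r : 2 ≤ r) (x+x≈0 : CharacteristicTwo (ring F)) where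

  private R = ring F
  open CommutativeRing R renaming (_*_ to infixl 7 _·_; setoid to K)
  open Inverse K↔Fin using (to; from; to-cong; from-cong; strictlyInverseˡ; strictlyInverseʳ)
  open FiniteField F K↔Fin
  open InCharacteristicTwo x+x≈0
  open AffineGroup R using (Mat; mat; module Mat; module V; module S; det; 1ᴹ; _≈ᴹ_; *ᴿ-cong; *ᴿ-zeroˡ; *ᴿ-identityʳ; *ᴿ-distribʳ;
    *ᴹ-identityˡ; *ᴹ-identityʳ; ≈ᴹ-refl; ≈ᴹ-sym; ≈ᴹ-trans)
    renaming (_*ᴿ_ to infixl 8 _*ᴿ_)
  open SemiringSolver commutativeSemiring using (solve; _:=_; _:+_)
  open Mat
  module T = Group (ASL2 R)

  linear : T.Carrier → Mat
  linear ((A , _) , _) = A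

  τ : V.Carrier → T.Carrier
  τ v = S.ε , v

  τ-∙ : ∀ v w → τ v T.∙ τ w T.≈ τ (v V.∙ w)
  τ-∙ v w = *ᴹ-identityˡ 1ᴹ , V.∙-congʳ (*ᴿ-identityʳ v)

  -- Normality of the translation group, with conjugation by t acting on it through the matrix of t.
  τ-conjugate : ∀ v t → τ v T.∙ t T.≈ t T.∙ τ (v *ᴿ linear t)
  τ-conjugate v t@((A , D) , b) =
    ≈ᴹ-trans (*ᴹ-identityˡ A) (≈ᴹ-sym (*ᴹ-identityʳ A)) ,
    V.trans (V.comm _ _) (V.∙-congʳ (V.sym (*ᴿ-identityʳ b)))

  τ-factor : ∀ t → t T.≈ (proj₁ t , V.ε) T.∙ τ (proj₂ t)
  τ-factor ((A , D) , b) =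
    ≈ᴹ-sym (*ᴹ-identityʳ A) , V.sym (V.trans (V.∙-congʳ (*ᴿ-zeroˡ 1ᴹ)) (V.identityˡ b))

  τ-square : ∀ t → e₁₁ (linear t) ≈ e₂₂ (linear t) → t T.∙ t T.≈ τ (proj₂ t *ᴿ linear t V.∙ proj₂ t)
  τ-square ((A , D) , b) a≈d = square≈1 A D a≈d , V.refl

  -- A matrix of determinant 1 is determined by its first row together with
  -- e₂₁ if e₁₁ ≠ 0, and with e₂₂ if e₁₁ = 0.
  thirdEntry : (A : Mat) → Dec (e₁₁ A ≈ 0#) → Carrier
  thirdEntry A (yes _) = e₂₂ A
  thirdEntry A (no _)  = e₂₁ A

  -- If a = 0, then bc = 1 and c is the inverse of b; if a ≠ 0, then ad = 1 + bc can be solved for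
  -- d. Equal first entries exclude the mixed cases.
  thirdEntry-determines : ∀ A B → det A ≈ 1# → det B ≈ 1# → e₁₁ A ≈ e₁₁ B → e₁₂ A ≈ e₁₂ B →
    ∀ p q → thirdEntry A p ≈ thirdEntry B q → A ≈ᴹ B
  thirdEntry-determines A B _ _ a≈ _ (yes a≈0) (no a′≉0) _ = contradiction (trans (sym a≈) a≈0) a′≉0
  thirdEntry-determines A B _ _ a≈ _ (no a≉0) (yes a′≈0) _ = contradiction (trans a≈ a′≈0) a≉0
  thirdEntry-determines (mat a b c d) (mat a′ b′ c′ d′) D D′ a≈ b≈ (yes a≈0) (yes a′≈0) d≈ =
    (a≈ , b≈) , (begin
      c                ≈⟨ *-identityʳ c ⟨
      c · 1#           ≈⟨ *-congˡ (bc≈1 a′≈0 D′) ⟨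
      c · (b′ · c′)    ≈⟨ *-assoc c b′ c′ ⟨
      c · b′ · c′      ≈⟨ *-congʳ (trans (*-comm c b′) (*-congʳ (sym b≈))) ⟩
      b · c · c′       ≈⟨ *-congʳ (bc≈1 a≈0 D) ⟩
      1# · c′          ≈⟨ *-identityˡ c′ ⟩
      c′               ∎) , d≈
    where
    open SetoidReasoning K
    bc≈1 : ∀ {a b c d} → a ≈ 0# → det (mat a b c d) ≈ 1# → b · c ≈ 1#
    bc≈1 {a} {b} {c} {d} a≈0 D = begin
      b · c            ≈⟨ +-identityʳ _ ⟨
      b · c + 0#       ≈⟨ swapMiddle (trans (sym (det≈1 D)) (trans (trans (*-congʳ a≈0) (zeroˡ d)) (sym (+-identityʳ 0#)))) ⟩
      1# + 0#          ≈⟨ +-identityʳ 1# ⟩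
      1#               ∎
  thirdEntry-determines (mat a b c d) (mat a′ b′ c′ d′) D D′ a≈ b≈ (no a≉0) (no _) c≈ =
    (a≈ , b≈) , (c≈ , *-cancelˡ a≉0 (begin
      a · d            ≈⟨ det≈1 D ⟩
      1# + b · c       ≈⟨ +-congˡ (*-cong b≈ c≈) ⟩
      1# + b′ · c′     ≈⟨ det≈1 D′ ⟨
      a′ · d′          ≈⟨ *-congʳ a≈ ⟨
      a · d′           ∎))
    where
    open SetoidReasoning K

  code : Mat → Fin (r ℕ.* r ℕ.* r)
  code A = combine (combine (to (e₁₁ A)) (to (e₁₂ A))) (to (thirdEntry A (e₁₁ A ≟ 0#)))

  code-injective : ∀ A B → det A ≈ 1# → det B ≈ 1# → code A ≡ code B → A ≈ᴹ B
  code-injective A B D E eq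
    with row , third ← Fin.combine-injective (combine (to (e₁₁ A)) _) _ (combine (to (e₁₁ B)) _) _ eq
    with a≡ , b≡ ← Fin.combine-injective (to (e₁₁ A)) _ (to (e₁₁ B)) _ row =
    thirdEntry-determines A B D E (to-injective a≡) (to-injective b≡)
      (e₁₁ A ≟ 0#) (e₁₁ B ≟ 0#) (to-injective third)

  -- Regularity of the translation group.

  module Regular {q} (q≡r² : q ≡ r ℕ.* r) (ρ : PermRep (ASL2 R) q) (ρ-2t : TwoTransitive (ASL2 R) ρ) where

    open Action (ASL2 R) ρ public

    act-τ-∙ : ∀ v w ω → act (τ w) (act (τ v) ω) ≡ act (τ (v V.∙ w)) ω
    act-τ-∙ v w ω = ≡.trans (≡.sym (act-∙ (τ v) (τ w) ω)) (act-cong {τ v T.∙ τ w} {τ (v V.∙ w)} (τ-∙ v w) ω)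

    act-τ-conjugate : ∀ v t ω → act t (act (τ v) ω) ≡ act (τ (v *ᴿ linear t)) (act t ω)
    act-τ-conjugate v t ω = begin
      act t (act (τ v) ω)                       ≡⟨ act-∙ (τ v) t ω ⟨
      act (τ v T.∙ t) ω                         ≡⟨ act-cong {τ v T.∙ t} {t T.∙ τ (v *ᴿ linear t)} (τ-conjugate v t) ω ⟩
      act (t T.∙ τ (v *ᴿ linear t)) ω           ≡⟨ act-∙ t (τ (v *ᴿ linear t)) ω ⟩
      act (τ (v *ᴿ linear t)) (act t ω)         ∎
      where open ≡.≡-Reasoning

    -- If the translations act trivially, then a matrix determines its action, and sending the
    -- images of two points under t to the matrix of t injects q (q - 1) pairs into r³ triples.
    translations-nontrivial : ¬ (∀ v ω → act (τ v) ω ≡ ω)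
    translations-nontrivial trivial = r²[r²∸1]≰r³ 2≤r
      (subst (λ q → q ℕ.* ℕ.pred q ≤ r ℕ.* r ℕ.* r) q≡r² (distinctPairs-≤ g g-injective))
      where
      base = distinctPoints (2≤q q≡r² 2≤r)
      ω₁ ω₂ : Fin q
      ω₁ = proj₁ base
      ω₂ = proj₁ (proj₂ base)
      mover : ∀ i j → i ≢ j → ∃[ t ] (act t ω₁ ≡ i × act t ω₂ ≡ j)
      mover i j = ρ-2t ω₁ ω₂ i j (proj₂ (proj₂ base))
      g : ∀ i j → i ≢ j → Fin (r ℕ.* r ℕ.* r)
      g i j i≢j = code (linear (proj₁ (mover i j i≢j)))
      act-linear : ∀ s t → linear s ≈ᴹ linear t → ∀ ω → act s ω ≡ act t ω
      act-linear (A , v) (B , w) A≈B ω = begin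
        act (A , v) ω                    ≡⟨ drop A v ⟩
        act (A , V.ε) ω                  ≡⟨ act-cong {A , V.ε} {B , V.ε} (A≈B , V.refl) ω ⟩
        act (B , V.ε) ω                  ≡⟨ drop B w ⟨
        act (B , w) ω                    ∎
        where
        open ≡.≡-Reasoning
        drop : ∀ A v → act (A , v) ω ≡ act (A , V.ε) ω
        drop A v = begin
          act (A , v) ω                      ≡⟨ act-cong {A , v} {(A , V.ε) T.∙ τ v} (τ-factor (A , v)) ω ⟩
          act ((A , V.ε) T.∙ τ v) ω          ≡⟨ act-∙ (A , V.ε) (τ v) ω ⟩
          act (τ v) (act (A , V.ε) ω)        ≡⟨ trivial v _ ⟩
          act (A , V.ε) ω                    ∎
      determined : ∀ {i j i′ j′} → ((s , _) : ∃[ s ] (act s ω₁ ≡ i × act s ω₂ ≡ j)) →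
        ((t , _) : ∃[ t ] (act t ω₁ ≡ i′ × act t ω₂ ≡ j′)) → code (linear s) ≡ code (linear t) → i ≡ i′ × j ≡ j′
      determined (s , ≡.refl , ≡.refl) (t , ≡.refl , ≡.refl) eq = s≗t ω₁ , s≗t ω₂
        where
        s≗t : ∀ ω → act s ω ≡ act t ω
        s≗t = act-linear s t (code-injective (linear s) (linear t) (proj₂ (proj₁ s)) (proj₂ (proj₁ t)) eq)
      g-injective : ∀ {i j i′ j′} i≢j i′≢j′ → g i j i≢j ≡ g i′ j′ i′≢j′ → i ≡ i′ × j ≡ j′
      g-injective {i} {j} {i′} {j′} i≢j i′≢j′ = determined (mover i j i≢j) (mover i′ j′ i′≢j′)

    moved : ∃[ v ] ∃[ ω ] act (τ v) ω ≢ ω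
    -- Up to `≈` every vector is `(from i , from j)`, so a finite search decides whether some
    -- translation moves a point.
    moved with Fin.any? (λ i → Fin.any? (λ j → Fin.any? (λ ω → ¬? (act (τ (from i , from j)) ω Fin.≟ ω))))
    ... | yes (i , j , ω , moves) = (from i , from j) , ω , moves
    ... | no fixed = contradiction trivial translations-nontrivial
      where
      trivial : ∀ v ω → act (τ v) ω ≡ ω
      trivial (x , y) ω = ≡.trans
        (act-cong {τ (x , y)} {τ (from (to x) , from (to y))}
          (≈ᴹ-refl , (sym (strictlyInverseʳ x) , sym (strictlyInverseʳ y))) ω)
        (decidable-stable (_ Fin.≟ _) (λ moves → fixed (to x , to y , ω , moves)))

    -- A normal subgroup moving some point is transitive: conjugate the move onto (ω, x).
    translate : ∀ ω x → ∃[ v ] act (τ v) ω ≡ x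
    translate ω x with ω Fin.≟ x
    ... | yes ω≡x = V.ε , ≡.trans (act-ε ω) ω≡x
    ... | no ω≢x with v , ω₀ , moves ← moved
      with t , eq₁ , eq₂ ← ρ-2t ω₀ (act (τ v) ω₀) ω x (moves ∘ ≡.sym) ω≢x =
      v *ᴿ linear t , (begin
        act (τ (v *ᴿ linear t)) ω                  ≡⟨ cong (act (τ (v *ᴿ linear t))) eq₁ ⟨
        act (τ (v *ᴿ linear t)) (act t ω₀)         ≡⟨ act-τ-conjugate v t ω₀ ⟨
        act t (act (τ v) ω₀)                       ≡⟨ eq₂ ⟩
        x                                          ∎)
      where open ≡.≡-Reasoning

    -- Coordinates x - ω of the points x from an origin ω.

    coordinate : Fin q → Fin q → V.Carrier
    coordinate ω x = proj₁ (translate ω x)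

    act-coordinate : ∀ ω x → act (τ (coordinate ω x)) ω ≡ x
    act-coordinate ω x = proj₂ (translate ω x)

    act-τ-cong : ∀ {v w} → v V.≈ w → ∀ ω → act (τ v) ω ≡ act (τ w) ω
    act-τ-cong {v} {w} v≈w = act-cong {τ v} {τ w} (≈ᴹ-refl , v≈w)

    encode : V.Carrier → Fin (r ℕ.* r)
    encode (x , y) = combine (to x) (to y)

    encode-injective : ∀ v w → encode v ≡ encode w → v V.≈ w
    encode-injective (x , y) (z , w) eq with x≡ , y≡ ← Fin.combine-injective (to x) (to y) (to z) (to w) eq =
      to-injective x≡ , to-injective y≡

    -- `coordinate ω` is injective, because `act-coordinate` recovers the point. It maps q = r²
    -- points to r² vectors, so it is onto: v is the coordinate of some y, and then y is the image
    -- of ω under `τ v`.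
    coordinate-act : ∀ ω v → coordinate ω (act (τ v) ω) V.≈ v
    coordinate-act ω v with injective⇒surjective {f = encode ∘ coordinate ω} q≡r² injective (encode v)
      where
      injective : Injective _≡_ _≡_ (encode ∘ coordinate ω)
      injective {x} {y} eq = begin
        x                               ≡⟨ act-coordinate ω x ⟨
        act (τ (coordinate ω x)) ω      ≡⟨ act-τ-cong (encode-injective (coordinate ω x) (coordinate ω y) eq) ω ⟩
        act (τ (coordinate ω y)) ω      ≡⟨ act-coordinate ω y ⟩
        y                               ∎
        where open ≡.≡-Reasoning
    ... | y , eq = V.trans (V.reflexive (cong (coordinate ω) (begin
      act (τ v) ω                      ≡⟨ act-τ-cong v≈ ω ⟨
      act (τ (coordinate ω y)) ω       ≡⟨ act-coordinate ω y ⟩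
      y                                ∎))) v≈
      where
      open ≡.≡-Reasoning
      v≈ : coordinate ω y V.≈ v
      v≈ = encode-injective (coordinate ω y) v eq

    act-τ-injective : ∀ ω {v w} → act (τ v) ω ≡ act (τ w) ω → v V.≈ w
    act-τ-injective ω {v} {w} eq = V.trans (V.sym (coordinate-act ω v))
      (V.trans (V.reflexive (cong (coordinate ω) eq)) (coordinate-act ω w))

    -- In coordinates from ω, t is the affine map v ↦ d + vA, where d is the coordinate of the image
    -- of ω.
    act-coordinate-∙ : ∀ ω v t → act t (act (τ v) ω) ≡ act (τ (coordinate ω (act t ω) V.∙ v *ᴿ linear t)) ω
    act-coordinate-∙ ω v t = begin
      act t (act (τ v) ω)                            ≡⟨ act-τ-conjugate v t ω ⟩
      act (τ (v *ᴿ linear t)) (act t ω)              ≡⟨ cong (act (τ (v *ᴿ linear t))) (act-coordinate ω (act t ω)) ⟨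
      act (τ (v *ᴿ linear t)) (act (τ d) ω)          ≡⟨ act-τ-∙ d (v *ᴿ linear t) ω ⟩
      act (τ (d V.∙ v *ᴿ linear t)) ω                ∎
      where
      open ≡.≡-Reasoning
      d = coordinate ω (act t ω)

    fixed⇔ : ∀ ω t x → act t x ≡ x ⇔
      coordinate ω (act t ω) V.∙ coordinate ω x *ᴿ linear t V.≈ coordinate ω x
    fixed⇔ ω t x = mk⇔
      (λ fix → act-τ-injective ω (≡.trans (≡.sym image) (≡.trans fix (≡.sym (act-coordinate ω x)))))
      (λ eq → ≡.trans image (≡.trans (act-τ-cong eq ω) (act-coordinate ω x)))
      where
      image : act t x ≡ act (τ (coordinate ω (act t ω) V.∙ coordinate ω x *ᴿ linear t)) ω
      image = ≡.trans (cong (act t) (≡.sym (act-coordinate ω x))) (act-coordinate-∙ ω (coordinate ω x) t)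

    coordinate-translation : ∀ ω t → linear t ≈ᴹ 1ᴹ → coordinate ω (act t ω) V.≈ proj₂ t
    coordinate-translation ω t A≈1 = V.trans
      (V.reflexive (cong (coordinate ω) (act-cong {t} {τ (proj₂ t)} (A≈1 , V.refl) ω)))
      (coordinate-act ω (proj₂ t))

    -- Both sides are the coordinate of the image of ω under t²: on the left by applying v ↦ d + vA
    -- to d, on the right because t² is a translation. The right side is the same for every action.
    coordinate-involution : ∀ ω t → e₁₁ (linear t) ≈ e₂₂ (linear t) →
      coordinate ω (act t ω) V.∙ coordinate ω (act t ω) *ᴿ linear t V.≈ proj₂ t *ᴿ linear t V.∙ proj₂ t
    coordinate-involution ω t a≈d = act-τ-injective ω (begin
      act (τ (d V.∙ d *ᴿ linear t)) ω             ≡⟨ act-coordinate-∙ ω d t ⟨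
      act t (act (τ d) ω)                         ≡⟨ cong (act t) (act-coordinate ω (act t ω)) ⟩
      act t (act t ω)                             ≡⟨ act-∙ t t ω ⟨
      act (t T.∙ t) ω                             ≡⟨ act-cong {t T.∙ t} {τ (proj₂ t *ᴿ linear t V.∙ proj₂ t)} (τ-square t a≈d) ω ⟩
      act (τ (proj₂ t *ᴿ linear t V.∙ proj₂ t)) ω ∎)
      where
      open ≡.≡-Reasoning
      d = coordinate ω (act t ω)

  -- Matching the fixed points of an element in two actions.

  module Comparison {q} (q≡r² : q ≡ r ℕ.* r) (ρ σ : PermRep (ASL2 R) q)
    (ρ-2t : TwoTransitive (ASL2 R) ρ) (σ-2t : TwoTransitive (ASL2 R) σ) (ω : Fin q) where

    private
      module ρ = Regular q≡r² ρ ρ-2t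
      module σ = Regular q≡r² σ σ-2t

    V-swapMiddle : ∀ {x y z w} → x V.∙ y V.≈ z V.∙ w → y V.∙ w V.≈ x V.∙ z
    V-swapMiddle (p , q) = swapMiddle p , swapMiddle q

    v∙v≈ε : ∀ v → v V.∙ v V.≈ V.ε
    v∙v≈ε (x , y) = x+x≈0 x , x+x≈0 y

    module _ (t : T.Carrier) where

      private
        A : Mat
        A = linear t

        d d′ : V.Carrier
        d = ρ.coordinate ω (ρ.act t ω)
        d′ = σ.coordinate ω (σ.act t ω)

      -- Both actions see t² as the same translation if t² is one, so d and d′
      -- differ by an element of the kernel of A - 1, which is its image.
      ∃-shift : ∃[ w ] w *ᴿ A V.≈ w V.∙ (d V.∙ d′)
      ∃-shift = ∃-displacement A (d V.∙ d′) (proj₂ (proj₁ t))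
        (λ A≈1 → V.trans (V.∙-cong (ρ.coordinate-translation ω t A≈1) (σ.coordinate-translation ω t A≈1))
                         (v∙v≈ε (proj₂ t)))
        (λ a≈d → V.trans (*ᴿ-distribʳ d d′ A) (V-swapMiddle
          (V.trans (ρ.coordinate-involution ω t a≈d) (V.sym (σ.coordinate-involution ω t a≈d)))))

      private
        w : V.Carrier
        w = proj₁ ∃-shift

      -- Sends the point with coordinate v in the first action to the one with coordinate v + w in
      -- the second. Adding w undoes itself in characteristic 2, so the inverse has the same form.
      shift : Permutation′ q
      shift = Perm.permutation
        (λ x → σ.act (τ (ρ.coordinate ω x V.∙ w)) ω)
        (λ y → ρ.act (τ (σ.coordinate ω y V.∙ w)) ω)
        (λ y → ≡.trans (σ.act-τ-cong (cancel (ρ.coordinate-act ω (σ.coordinate ω y V.∙ w))) ω) (σ.act-coordinate ω y))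
        (λ x → ≡.trans (ρ.act-τ-cong (cancel (σ.coordinate-act ω (ρ.coordinate ω x V.∙ w))) ω) (ρ.act-coordinate ω x))
        where
        cancel : ∀ {v u} → v V.≈ u V.∙ w → v V.∙ w V.≈ u
        cancel {v} {u} eq = V.trans (V.∙-congʳ eq) (V.trans (V.assoc u w w) (V.trans (V.∙-congˡ (v∙v≈ε w)) (V.identityʳ u)))

      -- Translation by w carries the map v ↦ d + vA to v ↦ d′ + vA: substituting wA = w + d + d′
      -- leaves d′ twice, and the two copies cancel.
      shifted-image : ∀ v → d′ V.∙ (v V.∙ w) *ᴿ A V.≈ (d V.∙ v *ᴿ A) V.∙ w
      shifted-image v = begin
        d′ V.∙ (v V.∙ w) *ᴿ A                         ≈⟨ V.∙-congˡ (*ᴿ-distribʳ v w A) ⟩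
        d′ V.∙ (v *ᴿ A V.∙ w *ᴿ A)                    ≈⟨ V.∙-congˡ (V.∙-congˡ (proj₂ ∃-shift)) ⟩
        d′ V.∙ (v *ᴿ A V.∙ (w V.∙ (d V.∙ d′)))        ≈⟨ rearrange d′ (v *ᴿ A) w d ⟩
        ((d V.∙ v *ᴿ A) V.∙ w) V.∙ (d′ V.∙ d′)        ≈⟨ V.∙-congˡ (v∙v≈ε d′) ⟩
        ((d V.∙ v *ᴿ A) V.∙ w) V.∙ V.ε                ≈⟨ V.identityʳ _ ⟩
        (d V.∙ v *ᴿ A) V.∙ w                          ∎
        where
        open SetoidReasoning V.setoid
        rearrange : ∀ a b c d → a V.∙ (b V.∙ (c V.∙ (d V.∙ a))) V.≈ ((d V.∙ b) V.∙ c) V.∙ (a V.∙ a)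
        rearrange (a₁ , a₂) (b₁ , b₂) (c₁ , c₂) (d₁ , d₂) = lemma a₁ b₁ c₁ d₁ , lemma a₂ b₂ c₂ d₂
          where
          lemma : ∀ a b c d → a + (b + (c + (d + a))) ≈ ((d + b) + c) + (a + a)
          lemma = solve 4 (λ a b c d → a :+ (b :+ (c :+ (d :+ a))) := ((d :+ b) :+ c) :+ (a :+ a)) refl

      fixed⇔fixed : ∀ x → ρ.act t x ≡ x ⇔ σ.act t (shift ⟨$⟩ʳ x) ≡ shift ⟨$⟩ʳ x
      fixed⇔fixed x = ⇔-sym (σ.fixed⇔ ω t (shift ⟨$⟩ʳ x)) ⇔-∘ (mk⇔ to′ from′ ⇔-∘ ρ.fixed⇔ ω t x)
        where
        v = ρ.coordinate ω x
        v′ = σ.coordinate ω (shift ⟨$⟩ʳ x)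
        v′≈ : v′ V.≈ v V.∙ w
        v′≈ = σ.coordinate-act ω (v V.∙ w)
        image : d′ V.∙ v′ *ᴿ A V.≈ (d V.∙ v *ᴿ A) V.∙ w
        image = V.trans (V.∙-congˡ (*ᴿ-cong {A = A} v′≈ ≈ᴹ-refl)) (shifted-image v)
        to′ : d V.∙ v *ᴿ A V.≈ v → d′ V.∙ v′ *ᴿ A V.≈ v′
        to′ eq = V.trans image (V.trans (V.∙-congʳ eq) (V.sym v′≈))
        from′ : d′ V.∙ v′ *ᴿ A V.≈ v′ → d V.∙ v *ᴿ A V.≈ v
        from′ eq = GroupProperties.∙-cancelʳ V.group w _ _ (V.trans (V.sym image) (V.trans eq v′≈))

    hamming-α : ∀ s t → hamming (α (ASL2 R) s ρ) (α (ASL2 R) t ρ) ≡ hamming (α (ASL2 R) s σ) (α (ASL2 R) t σ)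
    hamming-α = fixedPoints⇒hamming (ASL2 R) ρ σ (λ t → shift t , fixed⇔fixed t)

theorem5p1 : ∀ {c ℓ₁ ℓ₂} (f : ℕ) → 2 ≤ f → (F : HeytingField c ℓ₁ ℓ₂) →
    let r = 2 ^ f
        q = r ^ 2
        R = HeytingCommutativeRing.commutativeRing (HeytingField.heytingCommutativeRing F)
        T = ASL2 R
    in Inverse (CommutativeRing.setoid R) (setoid (Fin r)) →
       (ρ : Fin r → PermRep T q) →
       (∀ i → TwoTransitive T (ρ i)) →
       (∀ i j → i ≢ j → ¬ Equivalent T (ρ i) (ρ j)) →
       ∀ i →
         (Σ[ a ∈ (Fin (suc (r * q)) → ℚ) ]
            (IsInnerDistanceDistribution (familyCode T ρ) a ×
             IsInnerDistanceDistribution (Rep r (permCode T (ρ i))) a)) ×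
         (Σ[ δ ∈ ℕ ]
            (IsMinimumDistance (familyCode T ρ) δ ×
             IsMinimumDistance (Rep r (permCode T (ρ i))) δ))
theorem5p1 f 2≤f F K↔Fin ρ ρ-2t _ i =
  familyCode~Rep T ρ i (λ j → Comparison.hamming-α q≡r² (ρ j) (ρ i) (ρ-2t j) (ρ-2t i) ω₁)
    elements-enumerate {T.ε} {proj₁ mover} ω₁
    (λ eq → ω₁≢ω₂ (≡.trans (≡.sym (Action.act-ε T (ρ i) ω₁)) (≡.trans eq (proj₁ (proj₂ mover)))))
  where
  T = ASL2 (ring F)
  open FiniteField F K↔Fin using (order-2^f⇒characteristicTwo; elements-enumerate)
  2≤r : 2 ≤ 2 ^ f
  2≤r = ℕ.^-monoʳ-≤ 2 (ℕ.≤-trans (s≤s z≤n) 2≤f)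
  open AffineAction F K↔Fin 2≤r (order-2^f⇒characteristicTwo f ≡.refl) using (module Comparison; module T)
  q≡r² : (2 ^ f) ^ 2 ≡ 2 ^ f * 2 ^ f
  q≡r² = cong (2 ^ f *_) (ℕ.*-identityʳ (2 ^ f))
  points = distinctPoints (2≤q q≡r² 2≤r)
  ω₁ = proj₁ points
  ω₁≢ω₂ = proj₂ (proj₂ points)
  -- An element exchanging the two points. Its codeword differs from that of the identity, so there
  -- are two distinct codewords and the minimum distance exists.
  mover = ρ-2t i ω₁ (proj₁ (proj₂ points)) (proj₁ (proj₂ points)) ω₁ ω₁≢ω₂ (λ eq → ω₁≢ω₂ (≡.sym eq))
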